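{- Let $p>3$ be a prime. Then $$\sum_{k=0}^{(p-1)/2}\frac{3k+1}{16^k}\binom{2k}{k}^3\equiv p+2\left(\frac{ -1}{p}\right)p^3E_{p-3}\pmod{p^4}.$$
   Context: $\left(\frac{ -1}{p}\right)=(-1)^{(p-1)/2}$ is the Legendre symbol. $E_0,E_1,E_2,\dots$ are the Euler numbers, defined by $\frac{2}{e^t+e^{ -t}}=\sum_{n\ge0}E_n\frac{t^n}{n!}$. A congruence between rational numbers modulo $p^4$ means that their difference is a rational number whose numerator (in lowest terms) is divisible by $p^4$ and whose denominator is coprime to $p$. -}

module Defs where

open import Data.Bool using (Bool; true; false; if_then_else_)
open import Data.Nat as ℕ using (ℕ; zero; suc; _∸_; _^_; _<_)
open import Data.Nat.Properties using (m^n≢0)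
open import Data.Nat.Combinatorics using (_C_)
open import Data.Nat.Divisibility using (_∣_)
open import Data.Nat.Coprimality using (Coprime)
open import Data.Integer as ℤ using (ℤ; +_)
open import Data.Rational as ℚ using (ℚ; ↥_; ↧ₙ_)
open import Data.Product using (_×_)

sumℚ : ℕ → (ℕ → ℚ) → ℚ
sumℚ zero    f = f 0
sumℚ (suc n) f = sumℚ n f ℚ.+ f (suc n)

isEven : ℕ → Bool
isEven zero          = true
isEven (suc zero)    = false
isEven (suc (suc n)) = isEven n

negOnePow : ℕ → ℤ
negOnePow zero    = + 1
negOnePow (suc n) = ℤ.- negOnePow n

-- Euler numbers, from 2/(e^t+e^{-t}) = Σ E_n t^n/n!.
-- Multiplying by cosh t = Σ_{j even} t^j/j! gives
--   Σ_{j even, j ≤ n} C(n,j) E_{n-j} = [n = 0],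
-- i.e.  E_0 = 1  and  E_n = - Σ_{k < n, n - k even} C(n,k) E_k  for n ≥ 1.
-- eulerTable n is the function k ↦ E_k, valid for k ≤ n (course-of-values).
eulerTable : ℕ → (ℕ → ℤ)
eulerTable zero    k = + 1
eulerTable (suc n) k with k ℕ.≤ᵇ n
... | true  = eulerTable n k
... | false = ℤ.- go (suc n)
  where
    prev = eulerTable n
    go : ℕ → ℤ
    go zero    = + 0
    go (suc m) = go m ℤ.+ (if isEven (suc n ∸ m) then (+ (suc n C m)) ℤ.* prev m else + 0)

euler : ℕ → ℤ
euler n = eulerTable n n

legendreMinusOne : ℕ → ℤ
legendreMinusOne p = negOnePow ((p ∸ 1) ℕ./ 2)

_≡_mod[_]^_ : ℚ → ℚ → ℕ → ℕ → Set
x ≡ y mod[ p ]^ e =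
  let d = x ℚ.- y in
  ((p ^ e) ∣ ℤ.∣ ↥ d ∣) × Coprime (↧ₙ d) p

{-# OPTIONS --safe #-}
-- For p = 2n + 1 let N(x) = Σ_{k ≤ n} (3k + 1) C(2k, k) 4^(-k) Π_{j ≤ k} ((2j - 1)² - x) Π_{k < j ≤ n} (j² - x),
-- so that the sum in question is N(0) / n!².  A terminating hypergeometric sum, proved with a Wilf-Zeilberger
-- pair, gives N(m²) = m Π_{j ≤ n} (j² - m²) for every odd m ≤ p.  Since N has degree n, Lagrange interpolation
-- then expresses N(0) through Σ_{k ≤ n} (-1)^k C(p, k) Π_{j ≤ n} ((p - 2k)² - j²) with prefactor 1·3···(2n + 1).
-- The term k = 0 is ± n!² modulo p³ and the others are divisible by p²; modulo p³ these are multiples of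
-- p² / k² for 2k ≤ n and vanish for 2k > n, and Σ_{k ≤ n/2} 1/k² ≡ ± 4 E_{p-3} (mod p).
-- The prefactor is p times 1·3···(2n - 1), which Morley's congruence gives modulo p³.
module Submission where

open import Defs
open import Data.Bool using (true; false; if_then_else_)
open import Data.Nat as ℕ using (ℕ; zero; suc; _≤_; _<_; _≤ᵇ_; _∸_; _!; z≤n; s≤s; NonZero)
open import Data.Nat.Combinatorics using (_C_; nCk+nC[k+1]≡[n+1]C[k+1]; k>n⇒nCk≡0; nCn≡1; nC1≡n)
open import Data.Nat.Coprimality using (Coprime; recompute; prime⇒coprime; coprime-Bézout)
open import Data.Nat.Divisibility using (_∣_; divides; ∣-trans; m∣m*n)
open import Data.Nat.DivMod using (m*n/n≡m)
open import Data.Nat.GCD using (module Bézout)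
open import Data.Nat.Primality using (Prime; prime⇒irreducible)
open import Data.Nat.Properties as ℕₚ using (≤-refl; ≤∧≢⇒<; <⇒≤; m<n⇒m<1+n)
open import Data.Integer as ℤ using (ℤ; +_; ∣_∣; ≢-nonZero)
open import Data.Integer.Properties as ℤₚ using (*-cancelˡ-≡; *-cancelʳ-≡; *-assoc; *-comm; *-identityˡ; *-identityʳ; *-zeroˡ; *-zeroʳ; +-identityˡ; +-identityʳ; +-injective; i*j≡0⇒i≡0∨j≡0; i-j≡0⇒i≡j; pos-*; abs-*)
open import Data.Integer.Tactic.RingSolver using (solve-∀)
open import Data.Product using (∃; _×_; _,_; proj₁)
open import Data.Rational as ℚ using (ℚ; mkℚ; ↥_; ↧_; ↧ₙ_)
open import Data.Rational.Properties using (↥-/; ↧-/; ↥-+; ↧-+; ↥-neg; ↧-neg)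
open import Data.Sum using (_⊎_; inj₁; inj₂)
open import Relation.Binary.PropositionalEquality using (_≡_; _≢_; refl; sym; trans; cong; cong₂; subst; subst₂; module ≡-Reasoning)
open import Relation.Nullary using (yes; no)

-- The parameter x is introduced because only special values have a closed form: at x = m² with m
-- odd the factors (2j - 1)² - x cut the sum off after k = (m - 1)/2. The odd numbers from 1 to p
-- provide n + 1 such values, exactly what a polynomial of degree n requires, and the interpolation
-- weights at their squares are signed binomial coefficients C(p, k), nearly all divisible by p. The
-- node m = p is p-adically close to 0, which is why it carries the main term. The combinatorial
-- half is an exact identity between integers, cleared of denominators by powers of 2, factorials
-- and products of odd numbers; the prime enters only afterwards. There the obstacle is precision:
-- division is allowed only by units, and each factor p that can be split off lowers the exponent
-- needed for what remains, from p⁴ to p³ and finally to p. Inverses of squares modulo p are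
-- represented by powers with exponent p - 3. This is also how E_{p-3} appears: modulo p, an Euler
-- number of even index is an alternating power sum of odd numbers with that index as exponent.

module IntegerArithmetic where

  open import Data.Integer using (_+_; _*_; -_; _-_; _^_)

  -- Finite sums and products of integers.

  sum< : ℕ → (ℕ → ℤ) → ℤ
  sum< zero    f = + 0
  sum< (suc n) f = sum< n f + f n

  prod< : ℕ → (ℕ → ℤ) → ℤ
  prod< zero    f = + 1
  prod< (suc n) f = prod< n f * f n

  sum<-cong : ∀ n {f g} → (∀ i → i < n → f i ≡ g i) → sum< n f ≡ sum< n g
  sum<-cong zero    h = refl
  sum<-cong (suc n) h = cong₂ _+_ (sum<-cong n λ i i<n → h i (m<n⇒m<1+n i<n)) (h n ≤-refl)

  prod<-cong : ∀ n {f g} → (∀ i → i < n → f i ≡ g i) → prod< n f ≡ prod< n g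
  prod<-cong zero    h = refl
  prod<-cong (suc n) h = cong₂ _*_ (prod<-cong n λ i i<n → h i (m<n⇒m<1+n i<n)) (h n ≤-refl)

  sum<-zero : ∀ n {f} → (∀ i → i < n → f i ≡ + 0) → sum< n f ≡ + 0
  sum<-zero zero    h = refl
  sum<-zero (suc n) h = cong₂ _+_ (sum<-zero n λ i i<n → h i (m<n⇒m<1+n i<n)) (h n ≤-refl)

  sum<-+ : ∀ n f g → sum< n (λ i → f i + g i) ≡ sum< n f + sum< n g
  sum<-+ zero    f g = refl
  sum<-+ (suc n) f g rewrite sum<-+ n f g = shuffle (sum< n f) (sum< n g) (f n) (g n)
    where
    shuffle : ∀ a b c d → a + b + (c + d) ≡ a + c + (b + d)
    shuffle = solve-∀

  sum<-* : ∀ n c f → sum< n (λ i → c * f i) ≡ c * sum< n f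
  sum<-* zero    c f = sym (*-zeroʳ c)
  sum<-* (suc n) c f rewrite sum<-* n c f = factor c (sum< n f) (f n)
    where
    factor : ∀ c a b → c * a + c * b ≡ c * (a + b)
    factor = solve-∀

  prod<-* : ∀ n f g → prod< n (λ i → f i * g i) ≡ prod< n f * prod< n g
  prod<-* zero    f g = refl
  prod<-* (suc n) f g rewrite prod<-* n f g = shuffle (prod< n f) (prod< n g) (f n) (g n)
    where
    shuffle : ∀ a b c d → a * b * (c * d) ≡ a * c * (b * d)
    shuffle = solve-∀

  prod<-const : ∀ n c → prod< n (λ _ → c) ≡ c ^ n
  prod<-const zero    c = refl
  prod<-const (suc n) c rewrite prod<-const n c = swap (c ^ n) c
    where
    swap : ∀ a b → a * b ≡ b * a
    swap = solve-∀

  prod<-zero : ∀ n {f} i → i < n → f i ≡ + 0 → prod< n f ≡ + 0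
  prod<-zero (suc n) {f} i (s≤s i≤n) fi≡0 with i ℕ.≟ n
  ... | yes refl rewrite fi≡0 = *-zeroʳ (prod< n f)
  ... | no i≢n rewrite prod<-zero n {f} i (≤∧≢⇒< i≤n i≢n) fi≡0 = refl

  sum<-swap : ∀ m n (f : ℕ → ℕ → ℤ) → sum< m (λ i → sum< n (f i)) ≡ sum< n (λ j → sum< m (λ i → f i j))
  sum<-swap zero    n f = sym (sum<-zero n λ _ _ → refl)
  sum<-swap (suc m) n f rewrite sum<-swap m n f =
    sym (sum<-+ n (λ j → sum< m (λ i → f i j)) (f m))

  sum<-first : ∀ n f → sum< (suc n) f ≡ f 0 + sum< n (λ i → f (suc i))
  sum<-first zero    f = swap (f 0)
    where
    swap : ∀ a → + 0 + a ≡ a + + 0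
    swap = solve-∀
  sum<-first (suc n) f rewrite sum<-first n f = assoc (f 0) (sum< n (λ i → f (suc i))) (f (suc n))
    where
    assoc : ∀ a b c → a + b + c ≡ a + (b + c)
    assoc = solve-∀

  prod<-first : ∀ n f → prod< (suc n) f ≡ f 0 * prod< n (λ i → f (suc i))
  prod<-first zero    f = swap (f 0)
    where
    swap : ∀ a → + 1 * a ≡ a * + 1
    swap = solve-∀
  prod<-first (suc n) f rewrite prod<-first n f = assoc (f 0) (prod< n (λ i → f (suc i))) (f (suc n))
    where
    assoc : ∀ a b c → a * b * c ≡ a * (b * c)
    assoc = solve-∀

  sum<-++ : ∀ m n f → sum< (m ℕ.+ n) f ≡ sum< m f + sum< n (λ i → f (m ℕ.+ i))
  sum<-++ m zero f rewrite ℕₚ.+-identityʳ m = sym (+-identityʳ (sum< m f))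
  sum<-++ m (suc n) f rewrite ℕₚ.+-suc m n | sum<-++ m n f =
    assoc (sum< m f) (sum< n (λ i → f (m ℕ.+ i))) (f (m ℕ.+ n))
    where
    assoc : ∀ a b c → a + b + c ≡ a + (b + c)
    assoc = solve-∀

  prod<-++ : ∀ m n f → prod< (m ℕ.+ n) f ≡ prod< m f * prod< n (λ i → f (m ℕ.+ i))
  prod<-++ m zero f rewrite ℕₚ.+-identityʳ m = sym (*-identityʳ (prod< m f))
  prod<-++ m (suc n) f rewrite ℕₚ.+-suc m n | prod<-++ m n f =
    assoc (prod< m f) (prod< n (λ i → f (m ℕ.+ i))) (f (m ℕ.+ n))
    where
    assoc : ∀ a b c → a * b * c ≡ a * (b * c)
    assoc = solve-∀

  sum<-reverse : ∀ n f → sum< n f ≡ sum< n (λ i → f (n ℕ.∸ suc i))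
  sum<-reverse zero    f = refl
  sum<-reverse (suc n) f = begin
    sum< n f + f n                              ≡⟨ cong (_+ f n) (sum<-reverse n f) ⟩
    sum< n (λ i → f (n ℕ.∸ suc i)) + f n        ≡⟨ swap (sum< n (λ i → f (n ℕ.∸ suc i))) (f n) ⟩
    f n + sum< n (λ i → f (n ℕ.∸ suc i))        ≡⟨ sum<-first n (λ i → f (n ℕ.∸ i)) ⟨
    sum< (suc n) (λ i → f (n ℕ.∸ i))            ∎
    where
    open ≡-Reasoning
    swap : ∀ a b → a + b ≡ b + a
    swap = solve-∀

  prod<-reverse : ∀ n f → prod< n f ≡ prod< n (λ i → f (n ℕ.∸ suc i))
  prod<-reverse zero    f = refl
  prod<-reverse (suc n) f = begin
    prod< n f * f n                              ≡⟨ cong (_* f n) (prod<-reverse n f) ⟩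
    prod< n (λ i → f (n ℕ.∸ suc i)) * f n        ≡⟨ swap (prod< n (λ i → f (n ℕ.∸ suc i))) (f n) ⟩
    f n * prod< n (λ i → f (n ℕ.∸ suc i))        ≡⟨ prod<-first n (λ i → f (n ℕ.∸ i)) ⟨
    prod< (suc n) (λ i → f (n ℕ.∸ i))            ∎
    where
    open ≡-Reasoning
    swap : ∀ a b → a * b ≡ b * a
    swap = solve-∀

  -- Congruences of integers.

  infix 4 _≅_[_]
  -- The quotient is data: where two factors are both divisible by p, their quotients are taken out,
  -- multiplied and studied modulo p in turn.
  record _≅_[_] (a b M : ℤ) : Set where
    constructor by
    field
      quotient : ℤ
      equation : a ≡ b + M * quotient

  ≡⇒≅ : ∀ {M a b} → a ≡ b → a ≅ b [ M ]
  ≡⇒≅ {M} {a} refl = by (+ 0) (lemma M a)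
    where
    lemma : ∀ M a → a ≡ a + M * + 0
    lemma = solve-∀

  ≅-refl : ∀ {M a} → a ≅ a [ M ]
  ≅-refl = ≡⇒≅ refl

  ≅-sym : ∀ {M a b} → a ≅ b [ M ] → b ≅ a [ M ]
  ≅-sym {M} {b = b} (by q refl) = by (- q) (lemma M b q)
    where
    lemma : ∀ M b q → b ≡ b + M * q + M * - q
    lemma = solve-∀

  ≅-trans : ∀ {M a b c} → a ≅ b [ M ] → b ≅ c [ M ] → a ≅ c [ M ]
  ≅-trans {M} {c = c} (by q refl) (by r refl) = by (q + r) (lemma M c q r)
    where
    lemma : ∀ M c q r → c + M * r + M * q ≡ c + M * (q + r)
    lemma = solve-∀

  +-cong-≅ : ∀ {M a b c d} → a ≅ b [ M ] → c ≅ d [ M ] → a + c ≅ b + d [ M ]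
  +-cong-≅ {M} {b = b} {d = d} (by q refl) (by r refl) = by (q + r) (lemma M b d q r)
    where
    lemma : ∀ M b d q r → b + M * q + (d + M * r) ≡ b + d + M * (q + r)
    lemma = solve-∀

  *-cong-≅ : ∀ {M a b c d} → a ≅ b [ M ] → c ≅ d [ M ] → a * c ≅ b * d [ M ]
  *-cong-≅ {M} {b = b} {d = d} (by q refl) (by r refl) =
    by (b * r + q * d + M * q * r) (lemma M b d q r)
    where
    lemma : ∀ M b d q r → (b + M * q) * (d + M * r) ≡ b * d + M * (b * r + q * d + M * q * r)
    lemma = solve-∀

  neg-cong-≅ : ∀ {M a b} → a ≅ b [ M ] → - a ≅ - b [ M ]
  neg-cong-≅ {M} {b = b} (by q refl) = by (- q) (lemma M b q)
    where
    lemma : ∀ M b q → - (b + M * q) ≡ - b + M * - q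
    lemma = solve-∀

  ^-cong-≅ : ∀ {M a b} n → a ≅ b [ M ] → a ^ n ≅ b ^ n [ M ]
  ^-cong-≅ zero    a≅b = ≅-refl
  ^-cong-≅ (suc n) a≅b = *-cong-≅ a≅b (^-cong-≅ n a≅b)

  sum<-cong-≅ : ∀ {M} n {f g} → (∀ i → i < n → f i ≅ g i [ M ]) → sum< n f ≅ sum< n g [ M ]
  sum<-cong-≅ zero    h = ≅-refl
  sum<-cong-≅ (suc n) h =
    +-cong-≅ (sum<-cong-≅ n λ i i<n → h i (m<n⇒m<1+n i<n)) (h n ≤-refl)

  prod<-cong-≅ : ∀ {M} n {f g} → (∀ i → i < n → f i ≅ g i [ M ]) → prod< n f ≅ prod< n g [ M ]
  prod<-cong-≅ zero    h = ≅-refl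
  prod<-cong-≅ (suc n) h =
    *-cong-≅ (prod<-cong-≅ n λ i i<n → h i (m<n⇒m<1+n i<n)) (h n ≤-refl)

  -- The modulus grows with the factor. In this way a congruence modulo p³ gives one modulo p⁴ after
  -- multiplication by p, and one modulo p gives one modulo p³ after multiplication by p².
  scale-≅ : ∀ {M a b} c → a ≅ b [ M ] → c * a ≅ c * b [ c * M ]
  scale-≅ {M} {b = b} c (by q refl) = by q (lemma M b c q)
    where
    lemma : ∀ M b c q → c * (b + M * q) ≡ c * b + c * M * q
    lemma = solve-∀

  ≡-≅ : ∀ {M a b c} → a ≡ b → b ≅ c [ M ] → a ≅ c [ M ]
  ≡-≅ refl b≅c = b≅c

  ≅-≡ : ∀ {M a b c} → a ≅ b [ M ] → b ≡ c → a ≅ c [ M ]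
  ≅-≡ a≅b refl = a≅b

  -- Units modulo p and cancellation modulo powers of p.

  infixr 4 _,_
  -- An inverse modulo p only; `≅0-cancel` shows that it suffices for cancelling modulo every power
  -- of p.
  record Unit (p u : ℤ) : Set where
    constructor _,_
    field
      inverse  : ℤ
      inverseʳ : u * inverse ≅ + 1 [ p ]

  *-unit : ∀ {p u v} → Unit p u → Unit p v → Unit p (u * v)
  *-unit {u = u} {v} (w , uw) (x , vx) = w * x , ≡-≅ (lemma u v w x) (*-cong-≅ uw vx)
    where
    lemma : ∀ u v w x → u * v * (w * x) ≡ u * w * (v * x)
    lemma = solve-∀

  neg-unit : ∀ {p u} → Unit p u → Unit p (- u)
  neg-unit {u = u} (w , uw) = - w , ≡-≅ (lemma u w) uw
    where
    lemma : ∀ u w → - u * - w ≡ u * w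
    lemma = solve-∀

  ≅-unit : ∀ {p u v} → u ≅ v [ p ] → Unit p v → Unit p u
  ≅-unit u≅v (w , vw) = w , ≅-trans (*-cong-≅ u≅v ≅-refl) vw

  1-unit : ∀ {p} → Unit p (+ 1)
  1-unit = + 1 , ≅-refl

  ^-unit : ∀ {p u} n → Unit p u → Unit p (u ^ n)
  ^-unit zero    u = 1-unit
  ^-unit (suc n) u = *-unit u (^-unit n u)

  prod<-unit : ∀ {p} n {f} → (∀ i → i < n → Unit p (f i)) → Unit p (prod< n f)
  prod<-unit zero    h = 1-unit
  prod<-unit (suc n) h =
    *-unit (prod<-unit n λ i i<n → h i (m<n⇒m<1+n i<n)) (h n ≤-refl)

  -- Induction on the exponent: if z = p^e t is already known and u w = 1 + p q, then z = u z w -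
  -- p^e p q t. The first summand is divisible by p^(e + 1) by hypothesis, the second visibly.
  ≅0-cancel : ∀ {p u} .{{_ : ℤ.NonZero p}} → Unit p u → ∀ e {z} →
    u * z ≅ + 0 [ p ^ e ] → z ≅ + 0 [ p ^ e ]
  ≅0-cancel u zero {z} _ = by z (lemma z)
    where
    lemma : ∀ z → z ≡ + 0 + + 1 * z
    lemma = solve-∀
  ≅0-cancel {p} {u} un@(w , by q uw) (suc e) {z} (by y uz)
    with ≅0-cancel {p} un e {z} (by (p * y) (trans uz (lemma p (p ^ e) y)))
    where
    lemma : ∀ p P y → + 0 + p * P * y ≡ + 0 + P * (p * y)
    lemma = solve-∀
  ... | by t refl = by (y * w - q * t) (begin
      + 0 + p ^ e * t                                ≡⟨ lemma₁ (p ^ e) p q t ⟩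
      p ^ e * ((+ 1 + p * q) * t - p * q * t)        ≡⟨ cong (λ x → p ^ e * (x * t - p * q * t)) uw ⟨
      p ^ e * (u * w * t - p * q * t)                ≡⟨ lemma₂ (p ^ e) p q t u w ⟩
      u * (+ 0 + p ^ e * t) * w - p ^ e * (p * q * t) ≡⟨ cong (λ x → x * w - p ^ e * (p * q * t)) uz ⟩
      (+ 0 + p * p ^ e * y) * w - p ^ e * (p * q * t) ≡⟨ lemma₃ (p ^ e) p q t y w ⟩
      + 0 + p * p ^ e * (y * w - q * t)              ∎)
    where
    open ≡-Reasoning
    lemma₁ : ∀ P p q t → + 0 + P * t ≡ P * ((+ 1 + p * q) * t - p * q * t)
    lemma₁ = solve-∀
    lemma₂ : ∀ P p q t u w → P * (u * w * t - p * q * t) ≡ u * (+ 0 + P * t) * w - P * (p * q * t)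
    lemma₂ = solve-∀
    lemma₃ : ∀ P p q t y w → (+ 0 + p * P * y) * w - P * (p * q * t) ≡ + 0 + p * P * (y * w - q * t)
    lemma₃ = solve-∀

  ≅-cancel : ∀ {p u} .{{_ : ℤ.NonZero p}} → Unit p u → ∀ e {a b} →
    u * a ≅ u * b [ p ^ e ] → a ≅ b [ p ^ e ]
  ≅-cancel {p} {u} un e {a} {b} ua≅ub =
    ≅-≡ (≡-≅ (lemma₁ a b) (+-cong-≅ a-b≅0 (≅-refl {a = b}))) (lemma₄ b)
    where
    lemma₁ : ∀ a b → a ≡ (a - b) + b
    lemma₁ = solve-∀
    lemma₂ : ∀ u a b → u * (a - b) ≡ u * a + - (u * b)
    lemma₂ = solve-∀
    lemma₃ : ∀ x → x + - x ≡ + 0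
    lemma₃ = solve-∀
    lemma₄ : ∀ x → + 0 + x ≡ x
    lemma₄ = solve-∀
    a-b≅0 : a - b ≅ + 0 [ p ^ e ]
    a-b≅0 = ≅0-cancel un e (≡-≅ (lemma₂ u a b)
      (≅-≡ (+-cong-≅ ua≅ub (≅-refl {a = - (u * b)})) (lemma₃ (u * b))))

  ^1-≅ : ∀ {p a b} → a ≅ b [ p ] → a ≅ b [ p ^ 1 ]
  ^1-≅ {p} {b = b} (by q refl) = by q (lemma p b q)
    where
    lemma : ∀ p b q → b + p * q ≡ b + p * + 1 * q
    lemma = solve-∀

  ≅-^1 : ∀ {p a b} → a ≅ b [ p ^ 1 ] → a ≅ b [ p ]
  ≅-^1 {p} {b = b} (by q refl) = by q (lemma p b q)
    where
    lemma : ∀ p b q → b + p * + 1 * q ≡ b + p * q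
    lemma = solve-∀

  ≅-cancel₁ : ∀ {p u} .{{_ : ℤ.NonZero p}} → Unit p u → ∀ {a b} → u * a ≅ u * b [ p ] → a ≅ b [ p ]
  ≅-cancel₁ un ua≅ub = ≅-^1 (≅-cancel un 1 (^1-≅ ua≅ub))

  -- Binomial coefficients.

  c : ℕ → ℕ → ℤ
  c n k = + (n C k)

  c-pascal : ∀ n k → c (suc n) (suc k) ≡ c n k + c n (suc k)
  c-pascal n k = cong +_ (sym (nCk+nC[k+1]≡[n+1]C[k+1] n k))

  c-zero : ∀ {n k} → n < k → c n k ≡ + 0
  c-zero n<k = cong +_ (k>n⇒nCk≡0 n<k)

  c-n-n : ∀ n → c n n ≡ + 1
  c-n-n n = cong +_ (nCn≡1 n)

  c-absorb : ∀ n k → + suc k * c (suc n) (suc k) ≡ + suc n * c n k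
  c-absorb zero zero    = refl
  c-absorb zero (suc k) rewrite c-zero {1} {suc (suc k)} (s≤s (s≤s z≤n)) | c-zero {0} {suc k} (s≤s z≤n) =
    *-zeroʳ (+ suc (suc k))
  c-absorb (suc n) zero rewrite nC1≡n (suc (suc n)) = lemma (+ suc n)
    where
    lemma : ∀ n → + 1 * (+ 1 + n) ≡ (+ 1 + n) * + 1
    lemma = solve-∀
  c-absorb (suc n) (suc k) = begin
    + suc (suc k) * c (suc (suc n)) (suc (suc k))
      ≡⟨ cong (+ suc (suc k) *_) (c-pascal (suc n) (suc k)) ⟩
    + suc (suc k) * (c (suc n) (suc k) + c (suc n) (suc (suc k)))
      ≡⟨ lemma₁ (+ suc k) (c (suc n) (suc k)) (c (suc n) (suc (suc k))) ⟩
    (+ suc k * c (suc n) (suc k)) + c (suc n) (suc k) + + suc (suc k) * c (suc n) (suc (suc k))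
      ≡⟨ cong₂ (λ x y → x + c (suc n) (suc k) + y) (c-absorb n k) (c-absorb n (suc k)) ⟩
    + suc n * c n k + c (suc n) (suc k) + + suc n * c n (suc k)
      ≡⟨ lemma₂ (+ suc n) (c n k) (c n (suc k)) (c (suc n) (suc k)) ⟩
    + suc n * (c n k + c n (suc k)) + c (suc n) (suc k)
      ≡⟨ cong (λ x → + suc n * x + c (suc n) (suc k)) (c-pascal n k) ⟨
    + suc n * c (suc n) (suc k) + c (suc n) (suc k)
      ≡⟨ lemma₃ (+ suc n) (c (suc n) (suc k)) ⟩
    + suc (suc n) * c (suc n) (suc k)  ∎
    where
    open ≡-Reasoning
    lemma₁ : ∀ k x y → (+ 1 + k) * (x + y) ≡ k * x + x + (+ 1 + k) * y
    lemma₁ = solve-∀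
    lemma₂ : ∀ n x y z → n * x + z + n * y ≡ n * (x + y) + z
    lemma₂ = solve-∀
    lemma₃ : ∀ n x → n * x + x ≡ (+ 1 + n) * x
    lemma₃ = solve-∀

  c-absorb′ : ∀ n k → (+ suc n - + k) * c (suc n) k ≡ + suc n * c n k
  c-absorb′ n zero    = lemma (+ suc n)
    where
    lemma : ∀ n → (n - + 0) * + 1 ≡ n * + 1
    lemma = solve-∀
  c-absorb′ n (suc k) = begin
    (+ suc n - + suc k) * c (suc n) (suc k)
      ≡⟨ lemma₁ (+ suc n) (+ suc k) (c (suc n) (suc k)) ⟩
    + suc n * c (suc n) (suc k) - + suc k * c (suc n) (suc k)
      ≡⟨ cong₂ (λ x y → + suc n * x - y) (c-pascal n k) (c-absorb n k) ⟩
    + suc n * (c n k + c n (suc k)) - + suc n * c n k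
      ≡⟨ lemma₂ (+ suc n) (c n k) (c n (suc k)) ⟩
    + suc n * c n (suc k)  ∎
    where
    open ≡-Reasoning
    lemma₁ : ∀ n k x → (n - k) * x ≡ n * x - k * x
    lemma₁ = solve-∀
    lemma₂ : ∀ n x y → n * (x + y) - n * x ≡ n * y
    lemma₂ = solve-∀

  c-suc-n : ∀ n → c (suc n) n ≡ + suc n
  c-suc-n n = begin
    c (suc n) n                       ≡⟨ lemma (+ n) (c (suc n) n) ⟩
    (+ suc n - + n) * c (suc n) n     ≡⟨ c-absorb′ n n ⟩
    + suc n * c n n                   ≡⟨ cong (+ suc n *_) (c-n-n n) ⟩
    + suc n * + 1                     ≡⟨ lemma₁ (+ suc n) ⟩
    + suc n                           ∎
    where
    open ≡-Reasoning
    lemma : ∀ n x → x ≡ (+ 1 + n - n) * x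
    lemma = solve-∀
    lemma₁ : ∀ x → x * + 1 ≡ x
    lemma₁ = solve-∀

  binomial : ∀ m x → sum< (suc m) (λ k → c m k * x ^ k) ≡ (+ 1 + x) ^ m
  binomial zero    x = refl
  binomial (suc m) x = begin
    sum< (suc (suc m)) (λ k → c (suc m) k * x ^ k)
      ≡⟨ sum<-first (suc m) (λ k → c (suc m) k * x ^ k) ⟩
    + 1 * + 1 + sum< (suc m) (λ k → c (suc m) (suc k) * (x * x ^ k))
      ≡⟨ cong (λ y → + 1 * + 1 + y) (sum<-cong (suc m) λ k _ → trans (cong (_* (x * x ^ k)) (c-pascal m k)) (split (c m k) (c m (suc k)) x (x ^ k))) ⟩
    + 1 * + 1 + sum< (suc m) (λ k → x * (c m k * x ^ k) + c m (suc k) * x ^ suc k)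
      ≡⟨ cong (λ y → + 1 * + 1 + y) (sum<-+ (suc m) (λ k → x * (c m k * x ^ k)) (λ k → c m (suc k) * x ^ suc k)) ⟩
    + 1 * + 1 + (sum< (suc m) (λ k → x * (c m k * x ^ k)) + sum< (suc m) (λ k → c m (suc k) * x ^ suc k))
      ≡⟨ shuffle (+ 1 * + 1) (sum< (suc m) (λ k → x * (c m k * x ^ k))) (sum< (suc m) (λ k → c m (suc k) * x ^ suc k)) ⟩
    sum< (suc m) (λ k → x * (c m k * x ^ k)) + (+ 1 * + 1 + sum< (suc m) (λ k → c m (suc k) * x ^ suc k))
      ≡⟨ cong₂ _+_ (sum<-* (suc m) x (λ k → c m k * x ^ k)) (sym (sum<-first (suc m) (λ k → c m k * x ^ k))) ⟩
    x * S + (S + c m (suc m) * x ^ suc m)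
      ≡⟨ cong (λ y → x * S + (S + y * x ^ suc m)) (c-zero {m} {suc m} ≤-refl) ⟩
    x * S + (S + + 0 * x ^ suc m)
      ≡⟨ collect x S (x ^ suc m) ⟩
    (+ 1 + x) * S
      ≡⟨ cong ((+ 1 + x) *_) (binomial m x) ⟩
    (+ 1 + x) ^ suc m ∎
    where
    open ≡-Reasoning
    S : ℤ
    S = sum< (suc m) (λ k → c m k * x ^ k)
    split : ∀ a b x y → (a + b) * (x * y) ≡ x * (a * y) + b * (x * y)
    split = solve-∀
    shuffle : ∀ a b c → a + (b + c) ≡ b + (a + c)
    shuffle = solve-∀
    collect : ∀ x s y → x * s + (s + + 0 * y) ≡ (+ 1 + x) * s
    collect = solve-∀

  central : ℕ → ℤ
  central k = c (k ℕ.+ k) k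

  central-suc : ∀ k → + suc k * central (suc k) ≡ + 2 * (+ 2 * + k + + 1) * central k
  central-suc k = *-cancelˡ-≡ (+ suc k) _ _ (begin
    + suc k * (+ suc k * central (suc k))
      ≡⟨ cong (λ N → + suc k * (+ suc k * c (suc N) (suc k))) (ℕₚ.+-suc k k) ⟩
    + suc k * (+ suc k * c (suc (suc (k ℕ.+ k))) (suc k))
      ≡⟨ cong (+ suc k *_) (c-absorb (suc (k ℕ.+ k)) k) ⟩
    + suc k * (+ suc (suc (k ℕ.+ k)) * c (suc (k ℕ.+ k)) k)
      ≡⟨ lemma₁ (+ k) (c (suc (k ℕ.+ k)) k) ⟩
    + 2 * + suc k * ((+ suc (k ℕ.+ k) - + k) * c (suc (k ℕ.+ k)) k)
      ≡⟨ cong (+ 2 * + suc k *_) (c-absorb′ (k ℕ.+ k) k) ⟩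
    + 2 * + suc k * (+ suc (k ℕ.+ k) * central k)
      ≡⟨ lemma₂ (+ k) (central k) ⟩
    + suc k * (+ 2 * (+ 2 * + k + + 1) * central k) ∎)
    where
    open ≡-Reasoning
    lemma₁ : ∀ k x → (+ 1 + k) * ((+ 1 + (+ 1 + (k + k))) * x) ≡ + 2 * (+ 1 + k) * ((+ 1 + (k + k) - k) * x)
    lemma₁ = solve-∀
    lemma₂ : ∀ k x → + 2 * (+ 1 + k) * ((+ 1 + (k + k)) * x) ≡ (+ 1 + k) * (+ 2 * (+ 2 * k + + 1) * x)
    lemma₂ = solve-∀

  -- The recurrence of the Euler numbers.

  eulerTerm : ℕ → ℕ → ℤ
  eulerTerm n m = if isEven (suc n ∸ m) then + (suc n C m) * eulerTable n m else + 0

  mutual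
    -- The local sum of Defs.eulerTable cannot be named from here, so unification is left to find it:
    -- once the last two terms and the table index are abstracted, partialSum m k n x y can only be
    -- (the sum of eulerTerm m i over i < n) + x + y.
    partialSum : ℕ → ℕ → ℕ → ℤ → ℤ → ℤ
    partialSum = _

    eulerTable-partialSum : ∀ n k → (k ≤ᵇ suc n) ≡ false →
      eulerTable (suc (suc n)) k ≡
      - partialSum (suc n) k n (eulerTerm (suc n) n) (eulerTerm (suc n) (suc n))
    eulerTable-partialSum n k k≰ rewrite k≰ with eulerTerm (suc n) (suc n)
    ... | y with eulerTerm (suc n) n
    ...   | x with suc n
    ...     | m = refl

  partialSum-sum : ∀ m k n x y → partialSum m k n x y ≡ sum< n (eulerTerm m) + x + y
  partialSum-sum m k zero    x y = refl
  partialSum-sum m k (suc n) x y = cong (_+ y) (partialSum-sum m k n (eulerTerm m n) x)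

  ≤ᵇ-false : ∀ n → (suc n ≤ᵇ n) ≡ false
  ≤ᵇ-false zero    = refl
  ≤ᵇ-false (suc n) = ≤ᵇ-false n

  euler-rec : ∀ n → euler (suc (suc n)) ≡ - sum< (suc (suc n)) (eulerTerm (suc n))
  euler-rec n = trans (eulerTable-partialSum n (suc (suc n)) (≤ᵇ-false (suc n)))
                      (cong -_ (partialSum-sum (suc n) (suc (suc n)) n (eulerTerm (suc n) n) (eulerTerm (suc n) (suc n))))

  eulerTable-stable : ∀ n k → k ≤ n → eulerTable n k ≡ euler k
  eulerTable-stable n k k≤n with ℕₚ.≤⇒≤′ k≤n
  ... | k≤′n = go k≤′n
    where
    go : ∀ {n} → k ℕ.≤′ n → eulerTable n k ≡ euler k
    go ℕ.≤′-refl = refl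
    go {suc n} (ℕ.≤′-step k≤′n) with k ≤ᵇ n | ℕₚ.≤⇒≤ᵇ (ℕₚ.≤′⇒≤ k≤′n)
    ... | true | _ = go k≤′n

  -- Interpolation of polynomials at the squares of odd numbers.

  data Poly : ℕ → (ℤ → ℤ) → Set where
    -- The index is only a bound for the degree, free here, so that `added` can join summands of
    -- different degrees. The generators are chosen for evaluating linear functionals by induction:
    -- only `root` raises the bound.
    one    : ∀ {d} → Poly d (λ _ → + 1)
    root   : ∀ {d f} b → Poly d f → Poly (suc d) (λ x → (x - b) * f x)
    scaled : ∀ {d f} a → Poly d f → Poly d (λ x → a * f x)
    added  : ∀ {d f g} → Poly d f → Poly d g → Poly d (λ x → f x + g x)

  -- The number 2n + 1, by recursion so that `top (suc n)` unfolds to two successors, as two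
  -- applications of the absorption identities require.
  top : ℕ → ℕ
  top zero    = 1
  top (suc n) = suc (suc (top n))

  top-double : ∀ n → top n ≡ suc (n ℕ.+ n)
  top-double zero    = refl
  top-double (suc n) = cong suc (trans (cong suc (top-double n)) (sym (cong suc (ℕₚ.+-suc n n))))

  +top : ∀ n → + top n ≡ + 1 + (+ n + + n)
  +top n = cong +_ (top-double n)

  node : ℕ → ℕ → ℤ
  node n k = + top n - + 2 * + k

  weight : ℕ → ℕ → ℤ
  weight n k = negOnePow k * c (top n) k

  node-suc : ∀ n k → node (suc n) (suc k) ≡ node n k
  node-suc n k = lemma (+ top n) (+ k)
    where
    lemma : ∀ t k → + 1 + (+ 1 + t) - + 2 * (+ 1 + k) ≡ t - + 2 * k
    lemma = solve-∀

  step-factor : ℕ → ℤ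
  step-factor n = + 8 * + suc n * + top (suc n)

  -- With T = 2n + 3 and K = k + 1, (T - 2K)² - T² = -4K(T - K), and absorbing K and T - K into C(T,
  -- K) leaves T(T - 1) C(T - 2, k). Since T - 1 = 2(n + 1), this is the origin of `step-factor`.
  weight-step : ∀ n k →
    weight (suc n) (suc k) * (node (suc n) (suc k) * node (suc n) (suc k) - node (suc n) 0 * node (suc n) 0)
    ≡ step-factor n * weight n k
  weight-step n k = begin
    - s * c (suc (suc N)) (suc k) * ((T - + 2 * K) * (T - + 2 * K) - (T - + 0) * (T - + 0))
      ≡⟨ lemma₁ s (c (suc (suc N)) (suc k)) T K ⟩
    + 4 * s * ((T - K) * (K * c (suc (suc N)) (suc k)))
      ≡⟨ cong (λ y → + 4 * s * ((T - K) * y)) (c-absorb (suc N) k) ⟩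
    + 4 * s * ((T - K) * (T * c (suc N) k))
      ≡⟨ lemma₂ s (c (suc N) k) (+ N) (+ k) ⟩
    + 4 * s * (T * ((+ suc N - + k) * c (suc N) k))
      ≡⟨ cong (λ y → + 4 * s * (T * y)) (c-absorb′ N k) ⟩
    + 4 * s * (T * (+ suc N * c N k))
      ≡⟨ cong (λ y → + 4 * s * (T * ((+ 1 + y) * c N k))) (+top n) ⟩
    + 4 * s * (T * ((+ 1 + (+ 1 + (+ n + + n))) * c N k))
      ≡⟨ lemma₃ s (c N k) (+ n) T ⟩
    + 8 * + suc n * T * (s * c N k) ∎
    where
    open ≡-Reasoning
    N = top n
    s = negOnePow k
    T = + suc (suc N)
    K = + suc k
    lemma₁ : ∀ s x T K → - s * x * ((T - + 2 * K) * (T - + 2 * K) - (T - + 0) * (T - + 0)) ≡ + 4 * s * ((T - K) * (K * x))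
    lemma₁ = solve-∀
    lemma₂ : ∀ s x N k → + 4 * s * ((+ 1 + (+ 1 + N) - (+ 1 + k)) * ((+ 1 + (+ 1 + N)) * x)) ≡ + 4 * s * ((+ 1 + (+ 1 + N)) * ((+ 1 + N - k) * x))
    lemma₂ = solve-∀
    lemma₃ : ∀ s x n T → + 4 * s * (T * ((+ 1 + (+ 1 + (n + n))) * x)) ≡ + 8 * (+ 1 + n) * T * (s * x)
    lemma₃ = solve-∀

  c-middle : ∀ n → c (top n) (suc n) ≡ c (top n) n
  c-middle n rewrite top-double n = *-cancelˡ-≡ (+ suc n) _ _ (begin
    + suc n * c (suc (n ℕ.+ n)) (suc n)          ≡⟨ c-absorb (n ℕ.+ n) n ⟩
    + suc (n ℕ.+ n) * c (n ℕ.+ n) n              ≡⟨ c-absorb′ (n ℕ.+ n) n ⟨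
    (+ suc (n ℕ.+ n) - + n) * c (suc (n ℕ.+ n)) n        ≡⟨ cong (_* c (suc (n ℕ.+ n)) n) (lemma (+ n)) ⟩
    + suc n * c (suc (n ℕ.+ n)) n                ∎)
    where
    open ≡-Reasoning
    lemma : ∀ n → + 1 + (n + n) - n ≡ + 1 + n
    lemma = solve-∀

  -- With M = N + 2, absorption and Pascal's rule turn (M - 2k) C(M, k) into M (C(N, k) - C(N, k -
  -- 2)), whose alternating sum telescopes to a difference of two neighbouring coefficients. For odd
  -- N these are the two equal middle ones when the sum stops halfway.
  alternating-partial : ∀ N j →
    sum< (suc (suc j)) (λ k → negOnePow k * c (suc (suc N)) k * (+ suc (suc N) - + 2 * + k))
    ≡ + suc (suc N) * negOnePow (suc j) * (c N (suc j) - c N j)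
  alternating-partial N zero rewrite nC1≡n (suc (suc N)) | nC1≡n N = lemma (+ N)
    where
    lemma : ∀ N → + 0 + + 1 * + 1 * (+ 1 + (+ 1 + N) - + 2 * + 0) + - + 1 * (+ 1 + (+ 1 + N)) * (+ 1 + (+ 1 + N) - + 2 * + 1)
      ≡ (+ 1 + (+ 1 + N)) * - + 1 * (N - + 1)
    lemma = solve-∀
  alternating-partial N (suc j) = begin
    S + - - s * c M k * (+ M - + 2 * + k)
      ≡⟨ cong₂ _+_ (alternating-partial N j) (lemma₁ s (c M k) (+ M) (+ k)) ⟩
    + M * - s * (c N (suc j) - c N j) + s * ((+ M - + k) * c M k - + k * c M k)
      ≡⟨ cong₂ (λ x y → + M * - s * (c N (suc j) - c N j) + s * (x - y)) (c-absorb′ (suc N) k) (c-absorb (suc N) (suc j)) ⟩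
    + M * - s * (c N (suc j) - c N j) + s * (+ M * c (suc N) k - + M * c (suc N) (suc j))
      ≡⟨ cong₂ (λ x y → + M * - s * (c N (suc j) - c N j) + s * (+ M * x - + M * y)) (c-pascal N (suc j)) (c-pascal N j) ⟩
    + M * - s * (c N (suc j) - c N j) + s * (+ M * (c N (suc j) + c N k) - + M * (c N j + c N (suc j)))
      ≡⟨ lemma₂ (+ M) s (c N j) (c N (suc j)) (c N k) ⟩
    + M * - - s * (c N k - c N (suc j)) ∎
    where
    open ≡-Reasoning
    M = suc (suc N)
    k = suc (suc j)
    s = negOnePow j
    S = sum< k (λ k → negOnePow k * c M k * (+ M - + 2 * + k))
    lemma₁ : ∀ s x M k → - - s * x * (M - + 2 * k) ≡ s * ((M - k) * x - k * x)
    lemma₁ = solve-∀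
    lemma₂ : ∀ M s x y z → M * - s * (y - x) + s * (M * (y + z) - M * (x + y)) ≡ M * - - s * (z - y)
    lemma₂ = solve-∀

  functional : ℕ → (ℕ → ℤ) → (ℤ → ℤ) → ℤ
  functional n w f = sum< (suc n) (λ k → w k * f (node n k * node n k))

  functional-+ : ∀ n w f g → functional n w (λ x → f x + g x) ≡ functional n w f + functional n w g
  functional-+ n w f g = trans
    (sum<-cong (suc n) λ k _ → distrib (w k) (f (node n k * node n k)) (g (node n k * node n k)))
    (sum<-+ (suc n) _ _)
    where
    distrib : ∀ a b c → a * (b + c) ≡ a * b + a * c
    distrib = solve-∀

  functional-* : ∀ n w a f → functional n w (λ x → a * f x) ≡ a * functional n w f
  functional-* n w a f = trans
    (sum<-cong (suc n) λ k _ → swap (w k) a (f (node n k * node n k)))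
    (sum<-* (suc n) a _)
    where
    swap : ∀ a b c → a * (b * c) ≡ b * (a * c)
    swap = solve-∀

  functional-root : ∀ n w a b f → functional n w (λ x → (x - b) * f x)
    ≡ functional n w (λ x → (x - a) * f x) + (a - b) * functional n w f
  functional-root n w a b f = begin
    functional n w (λ x → (x - b) * f x)
      ≡⟨ sum<-cong (suc n) (λ k _ → split (w k) (node n k * node n k) a b (f (node n k * node n k))) ⟩
    functional n w (λ x → (x - a) * f x + (a - b) * f x)
      ≡⟨ functional-+ n w (λ x → (x - a) * f x) (λ x → (a - b) * f x) ⟩
    functional n w (λ x → (x - a) * f x) + functional n w (λ x → (a - b) * f x)
      ≡⟨ cong (λ y → functional n w (λ x → (x - a) * f x) + y) (functional-* n w (a - b) f) ⟩
    functional n w (λ x → (x - a) * f x) + (a - b) * functional n w f  ∎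
    where
    open ≡-Reasoning
    split : ∀ w x a b y → w * ((x - b) * y) ≡ w * ((x - a) * y + (a - b) * y)
    split = solve-∀

  -- Multiplying by x - x₀ for the largest node x₀ removes that node.
  functional-drop : ∀ n w w′ σ f →
    (∀ k → w (suc k) * (node (suc n) (suc k) * node (suc n) (suc k) - node (suc n) 0 * node (suc n) 0) ≡ σ * w′ k) →
    functional (suc n) w (λ x → (x - node (suc n) 0 * node (suc n) 0) * f x) ≡ σ * functional n w′ f
  functional-drop n w w′ σ f step = begin
    functional (suc n) w (λ x → (x - x₀) * f x)
      ≡⟨ sum<-first (suc n) (λ k → w k * ((node (suc n) k * node (suc n) k - x₀) * f (node (suc n) k * node (suc n) k))) ⟩
    w 0 * ((x₀ - x₀) * f x₀) + sum< (suc n) (λ k → w (suc k) * ((node (suc n) (suc k) * node (suc n) (suc k) - x₀) * f (node (suc n) (suc k) * node (suc n) (suc k))))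
      ≡⟨ cong₂ _+_ (vanish (w 0) x₀ (f x₀)) (sum<-cong (suc n) λ k _ → term k) ⟩
    + 0 + sum< (suc n) (λ k → σ * (w′ k * f (node n k * node n k)))
      ≡⟨ +-identityˡ _ ⟩
    sum< (suc n) (λ k → σ * (w′ k * f (node n k * node n k)))
      ≡⟨ sum<-* (suc n) σ _ ⟩
    σ * functional n w′ f ∎
    where
    open ≡-Reasoning
    x₀ = node (suc n) 0 * node (suc n) 0
    vanish : ∀ w x y → w * ((x - x) * y) ≡ + 0
    vanish = solve-∀
    assoc : ∀ a b c → a * (b * c) ≡ a * b * c
    assoc = solve-∀
    term : ∀ k → w (suc k) * ((node (suc n) (suc k) * node (suc n) (suc k) - x₀) * f (node (suc n) (suc k) * node (suc n) (suc k)))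
      ≡ σ * (w′ k * f (node n k * node n k))
    term k = begin
      w (suc k) * ((x - x₀) * f x)            ≡⟨ assoc (w (suc k)) (x - x₀) (f x) ⟩
      w (suc k) * (x - x₀) * f x              ≡⟨ cong₂ _*_ (step k) (cong (λ m → f (m * m)) (node-suc n k)) ⟩
      σ * w′ k * f (node n k * node n k)      ≡⟨ assoc σ (w′ k) _ ⟨
      σ * (w′ k * f (node n k * node n k))    ∎
      where x = node (suc n) (suc k) * node (suc n) (suc k)

  -- Up to a constant factor these are the weights of the divided difference at the points m², m odd
  -- and at most 2n + 1: the reciprocal of the product of the differences m² - m'² is proportional
  -- to (-1)^k m C(2n + 1, k) for m = `node n k`.
  oddWeight : ℕ → ℕ → ℤ
  oddWeight n k = weight n k * node n k

  oddWeight-step : ∀ n k →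
    oddWeight (suc n) (suc k) * (node (suc n) (suc k) * node (suc n) (suc k) - node (suc n) 0 * node (suc n) 0)
    ≡ step-factor n * oddWeight n k
  oddWeight-step n k = begin
    weight (suc n) (suc k) * m * d     ≡⟨ swap (weight (suc n) (suc k)) m d ⟩
    weight (suc n) (suc k) * d * m     ≡⟨ cong₂ _*_ (weight-step n k) (node-suc n k) ⟩
    step-factor n * weight n k * node n k    ≡⟨ assoc (step-factor n) (weight n k) (node n k) ⟩
    step-factor n * oddWeight n k      ∎
    where
    open ≡-Reasoning
    m = node (suc n) (suc k)
    d = m * m - node (suc n) 0 * node (suc n) 0
    swap : ∀ a b c → a * b * c ≡ a * c * b
    swap = solve-∀
    assoc : ∀ a b c → a * b * c ≡ a * (b * c)
    assoc = solve-∀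

  functional-odd-one : ∀ n → functional (suc n) (oddWeight (suc n)) (λ _ → + 1) ≡ + 0
  functional-odd-one n = begin
    functional (suc n) (oddWeight (suc n)) (λ _ → + 1)
      ≡⟨ sum<-cong (suc (suc n)) (λ k _ → *-identityʳ (oddWeight (suc n) k)) ⟩
    sum< (suc (suc n)) (λ k → negOnePow k * c (top (suc n)) k * (+ top (suc n) - + 2 * + k))
      ≡⟨ alternating-partial (top n) n ⟩
    + suc (suc (top n)) * negOnePow (suc n) * (c (top n) (suc n) - c (top n) n)
      ≡⟨ cong (λ y → + suc (suc (top n)) * negOnePow (suc n) * (y - c (top n) n)) (c-middle n) ⟩
    + suc (suc (top n)) * negOnePow (suc n) * (c (top n) n - c (top n) n)
      ≡⟨ vanish (+ suc (suc (top n)) * negOnePow (suc n)) (c (top n) n) ⟩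
    + 0 ∎
    where
    open ≡-Reasoning
    vanish : ∀ a x → a * (x - x) ≡ + 0
    vanish = solve-∀

  -- A divided difference of order n kills degrees below n. A factor x - b is exchanged for x - x₀
  -- with x₀ the largest point: this lowers both n and the degree by one, and the correction is a
  -- multiple of the remaining factor alone.
  functional-odd : ∀ {d f} n → Poly d f → d < n → functional n (oddWeight n) f ≡ + 0
  functional-odd (suc n) one _ = functional-odd-one n
  functional-odd (suc n) (root {f = f} b p) (s≤s d<n) = begin
    functional (suc n) (oddWeight (suc n)) (λ x → (x - b) * f x)
      ≡⟨ functional-root (suc n) (oddWeight (suc n)) x₀ b f ⟩
    functional (suc n) (oddWeight (suc n)) (λ x → (x - x₀) * f x) + (x₀ - b) * functional (suc n) (oddWeight (suc n)) f
      ≡⟨ cong₂ (λ y z → y + (x₀ - b) * z)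
           (trans (functional-drop n (oddWeight (suc n)) (oddWeight n) (step-factor n) f (oddWeight-step n))
                  (cong (step-factor n *_) (functional-odd n p d<n)))
           (functional-odd (suc n) p (m<n⇒m<1+n d<n)) ⟩
    step-factor n * + 0 + (x₀ - b) * + 0
      ≡⟨ vanish (step-factor n) (x₀ - b) ⟩
    + 0 ∎
    where
    open ≡-Reasoning
    x₀ = node (suc n) 0 * node (suc n) 0
    vanish : ∀ a b → a * + 0 + b * + 0 ≡ + 0
    vanish = solve-∀
  functional-odd n (scaled {f = f} a p) d<n = trans (functional-* n (oddWeight n) a f)
    (trans (cong (a *_) (functional-odd n p d<n)) (*-zeroʳ a))
  functional-odd n (added {f = f} {g} p q) d<n = trans (functional-+ n (oddWeight n) f g)
    (cong₂ _+_ (functional-odd n p d<n) (functional-odd n q d<n))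

  oddFactorial : ℕ → ℤ
  oddFactorial zero    = + 1
  oddFactorial (suc n) = oddFactorial n * + top (suc n)

  -- The product of the odd numbers up to 2n + 1 with node n k omitted.
  cofactor : ℕ → ℕ → ℤ
  cofactor zero    _       = + 1
  cofactor (suc n) zero    = oddFactorial n
  cofactor (suc n) (suc k) = + top (suc n) * cofactor n k

  cofactor-node : ∀ n k → k ≤ n → cofactor n k * node n k ≡ oddFactorial n
  cofactor-node zero    zero    _ = refl
  cofactor-node (suc n) zero    _ = lemma (oddFactorial n) (+ top (suc n))
    where
    lemma : ∀ a b → a * (b - + 2 * + 0) ≡ a * b
    lemma = solve-∀
  cofactor-node (suc n) (suc k) (s≤s k≤n) = begin
    + top (suc n) * cofactor n k * node (suc n) (suc k) ≡⟨ cong (+ top (suc n) * cofactor n k *_) (node-suc n k) ⟩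
    + top (suc n) * cofactor n k * node n k             ≡⟨ lemma (+ top (suc n)) (cofactor n k) (node n k) ⟩
    cofactor n k * node n k * + top (suc n)             ≡⟨ cong (_* + top (suc n)) (cofactor-node n k k≤n) ⟩
    oddFactorial n * + top (suc n)                      ∎
    where
    open ≡-Reasoning
    lemma : ∀ a b c → a * b * c ≡ b * c * a
    lemma = solve-∀

  -- `oddWeight` divided by the point m² itself and cleared of denominators by `oddFactorial`.
  -- Adjoining 0 to the points of a divided difference produces this quotient, so these weights
  -- extract the value at 0.
  evenWeight : ℕ → ℕ → ℤ
  evenWeight n k = weight n k * cofactor n k

  evenWeight-step : ∀ n k →
    evenWeight (suc n) (suc k) * (node (suc n) (suc k) * node (suc n) (suc k) - node (suc n) 0 * node (suc n) 0)
    ≡ step-factor n * + top (suc n) * evenWeight n k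
  evenWeight-step n k = begin
    weight (suc n) (suc k) * (t * cofactor n k) * d   ≡⟨ swap (weight (suc n) (suc k)) t (cofactor n k) d ⟩
    weight (suc n) (suc k) * d * (t * cofactor n k)   ≡⟨ cong (_* (t * cofactor n k)) (weight-step n k) ⟩
    step-factor n * weight n k * (t * cofactor n k)   ≡⟨ assoc (step-factor n) (weight n k) t (cofactor n k) ⟩
    step-factor n * t * evenWeight n k                ∎
    where
    open ≡-Reasoning
    t = + top (suc n)
    d = node (suc n) (suc k) * node (suc n) (suc k) - node (suc n) 0 * node (suc n) 0
    swap : ∀ a t b c → a * (t * b) * c ≡ a * c * (t * b)
    swap = solve-∀
    assoc : ∀ σ a t b → σ * a * (t * b) ≡ σ * t * (a * b)
    assoc = solve-∀

  functional-even-x : ∀ n f → functional n (evenWeight n) (λ x → x * f x) ≡ oddFactorial n * functional n (oddWeight n) f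
  functional-even-x n f = trans (sum<-cong (suc n) λ k k<1+n → term k (ℕ.s≤s⁻¹ k<1+n)) (sum<-* (suc n) (oddFactorial n) _)
    where
    lemma : ∀ a b m y → a * b * (m * m * y) ≡ b * m * (a * m * y)
    lemma = solve-∀
    term : ∀ k → k ≤ n → evenWeight n k * (node n k * node n k * f (node n k * node n k))
      ≡ oddFactorial n * (oddWeight n k * f (node n k * node n k))
    term k k≤n = trans (lemma (weight n k) (cofactor n k) (node n k) (f (node n k * node n k)))
      (cong (_* (oddWeight n k * f (node n k * node n k))) (cofactor-node n k k≤n))

  evenMass : ℕ → ℤ
  evenMass zero    = + 1
  evenMass (suc n) = - (+ 8 * + suc n) * evenMass n

  -- The functional is computed on x - t² in two ways, where t² is the largest point. Dropping that
  -- point gives a multiple of the mass for n; on the other hand x contributes nothing by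
  -- `functional-odd-one`, so the value is -t² times the mass sought.
  functional-even-one : ∀ n → functional n (evenWeight n) (λ _ → + 1) ≡ evenMass n
  functional-even-one zero    = refl
  functional-even-one (suc n) = *-cancelˡ-≡ (t * t) _ _ (begin
    t * t * V                                 ≡⟨ lemma₁ t V A ⟩
    A + (t′ * t′ - + 0) * V - A               ≡⟨ cong (_- A) (functional-root (suc n) v (t′ * t′) (+ 0) (λ _ → + 1)) ⟨
    functional (suc n) v (λ x → (x - + 0) * + 1) - A
      ≡⟨ cong₂ _-_ (trans (sum<-cong (suc (suc n)) λ k _ → cong (v k *_) (lemma₀ (node (suc n) k * node (suc n) k)))
                      (trans (functional-even-x (suc n) (λ _ → + 1))
                        (cong (oddFactorial (suc n) *_) (functional-odd-one n))))
                   (trans (functional-drop n v (evenWeight n) (step-factor n * t) (λ _ → + 1) (evenWeight-step n))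
                      (cong (step-factor n * t *_) (functional-even-one n))) ⟩
    oddFactorial (suc n) * + 0 - step-factor n * t * evenMass n
      ≡⟨ lemma₂ (oddFactorial (suc n)) (+ suc n) t (evenMass n) ⟩
    t * t * (- (+ 8 * + suc n) * evenMass n)  ∎)
    where
    open ≡-Reasoning
    t = + top (suc n)
    t′ = node (suc n) 0
    v = evenWeight (suc n)
    V = functional (suc n) v (λ _ → + 1)
    A = functional (suc n) v (λ x → (x - t′ * t′) * + 1)
    lemma₀ : ∀ x → (x - + 0) * + 1 ≡ x * + 1
    lemma₀ = solve-∀
    lemma₁ : ∀ t V A → t * t * V ≡ A + ((t - + 2 * + 0) * (t - + 2 * + 0) - + 0) * V - A
    lemma₁ = solve-∀
    lemma₂ : ∀ D s t K → D * + 0 - + 8 * s * t * t * K ≡ t * t * (- (+ 8 * s) * K)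
    lemma₂ = solve-∀

  -- In the case of a root, x - b is split as x plus the constant -b. The part x f falls to
  -- `functional-odd`, whose strict degree bound holds because f has degree one less.
  functional-even : ∀ {d f} n → Poly d f → d ≤ n → functional n (evenWeight n) f ≡ evenMass n * f (+ 0)
  functional-even n one _ = trans (functional-even-one n) (sym (*-identityʳ (evenMass n)))
  functional-even n (root {f = f} b p) d<n = begin
    functional n v (λ x → (x - b) * f x)
      ≡⟨ functional-root n v (+ 0) b f ⟩
    functional n v (λ x → (x - + 0) * f x) + (+ 0 - b) * functional n v f
      ≡⟨ cong₂ (λ y z → y + (+ 0 - b) * z)
           (trans (sum<-cong (suc n) λ k _ → cong (λ x → v k * (x * f (node n k * node n k))) (+-identityʳ (node n k * node n k)))
             (trans (functional-even-x n f) (cong (oddFactorial n *_) (functional-odd n p d<n))))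
           (functional-even n p (<⇒≤ d<n)) ⟩
    oddFactorial n * + 0 + (+ 0 - b) * (evenMass n * f (+ 0))
      ≡⟨ lemma (oddFactorial n) b (evenMass n) (f (+ 0)) ⟩
    evenMass n * ((+ 0 - b) * f (+ 0)) ∎
    where
    open ≡-Reasoning
    v = evenWeight n
    lemma : ∀ D b K y → D * + 0 + (+ 0 - b) * (K * y) ≡ K * ((+ 0 - b) * y)
    lemma = solve-∀
  functional-even n (scaled {f = f} a p) d≤n = trans (functional-* n (evenWeight n) a f)
    (trans (cong (a *_) (functional-even n p d≤n)) (swap a (evenMass n) (f (+ 0))))
    where
    swap : ∀ a b c → a * (b * c) ≡ b * (a * c)
    swap = solve-∀
  functional-even n (added {f = f} {g} p q) d≤n = trans (functional-+ n (evenWeight n) f g)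
    (trans (cong₂ _+_ (functional-even n p d≤n) (functional-even n q d≤n))
           (factor (evenMass n) (f (+ 0)) (g (+ 0))))
    where
    factor : ∀ a b c → a * b + a * c ≡ a * (b + c)
    factor = solve-∀

  -- The deformed sum as a polynomial.

  evenRoots : ℕ → ℤ → ℤ
  evenRoots n x = prod< n (λ j → x - + suc j * + suc j)

  evenRoots₄ : ℕ → ℤ → ℤ
  evenRoots₄ n x = prod< n (λ j → + 4 * (x - + suc j * + suc j))

  oddRoots : ℕ → ℤ → ℤ
  oddRoots zero    x = + 1
  oddRoots (suc n) x = (x - + top n * + top n) * oddRoots n x

  coefficient : ℕ → ℤ
  coefficient k = (+ 3 * + k + + 1) * central k

  -- (-4)^n N(x)
  deformed : ℕ → ℤ → ℤ
  deformed zero    x = + 1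
  deformed (suc n) x = + 4 * ((x - + suc n * + suc n) * deformed n x) + coefficient (suc n) * oddRoots (suc n) x

  oddRoots-poly : ∀ n → Poly n (oddRoots n)
  oddRoots-poly zero    = one
  oddRoots-poly (suc n) = root (+ top n * + top n) (oddRoots-poly n)

  deformed-poly : ∀ n → Poly n (deformed n)
  deformed-poly zero    = one
  deformed-poly (suc n) = added (scaled (+ 4) (root (+ suc n * + suc n) (deformed-poly n)))
                                (scaled (coefficient (suc n)) (oddRoots-poly (suc n)))

  -- The Wilf-Zeilberger pair: comparing the neighbouring odd numbers 2a - 1 and 2a + 1.

  module _ (a : ℤ) where
    private
      l u x y : ℤ
      l = + 2 * a - + 1
      u = + 2 * a + + 1
      x = l * l
      y = u * u

    -- The products that remain common to both neighbours: (2a - 1)² - (2j - 1)² = 4(a - j)(a + j -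
    -- 1) and (2a + 1)² - (2j - 1)² = 4(a - j + 1)(a + j), so that the full products differ only by
    -- linear factors at their ends. The same happens for the roots j², with 2a in place of a and
    -- two linear factors.
    shared₁ shared₂ : ℕ → ℤ
    shared₁ k = prod< k (λ j → + 4 * (a * a - + j * + j))
    shared₂ k = prod< k (λ j → + 4 * (+ 4 * (a * a) - + j * + j))

    oddRoots-lower : ∀ k → a * oddRoots k x ≡ (a - + k) * shared₁ k
    oddRoots-lower zero    = lemma a
      where
      lemma : ∀ a → a * + 1 ≡ (a - + 0) * + 1
      lemma = solve-∀
    oddRoots-lower (suc k) = begin
      a * ((x - + top k * + top k) * oddRoots k x)  ≡⟨ cong (λ t → a * ((x - t * t) * oddRoots k x)) (+top k) ⟩
      a * ((x - t * t) * oddRoots k x)              ≡⟨ lemma₁ a (+ k) (oddRoots k x) ⟩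
      + 4 * (a - (+ 1 + + k)) * (a + + k) * (a * oddRoots k x)  ≡⟨ cong (λ z → + 4 * (a - (+ 1 + + k)) * (a + + k) * z) (oddRoots-lower k) ⟩
      + 4 * (a - (+ 1 + + k)) * (a + + k) * ((a - + k) * shared₁ k)  ≡⟨ lemma₂ a (+ k) (shared₁ k) ⟩
      (a - + suc k) * (shared₁ k * (+ 4 * (a * a - + k * + k)))  ∎
      where
      open ≡-Reasoning
      t = + 1 + (+ k + + k)
      lemma₁ : ∀ a k z → a * (((+ 2 * a - + 1) * (+ 2 * a - + 1) - (+ 1 + (k + k)) * (+ 1 + (k + k))) * z) ≡ + 4 * (a - (+ 1 + k)) * (a + k) * (a * z)
      lemma₁ = solve-∀
      lemma₂ : ∀ a k s → + 4 * (a - (+ 1 + k)) * (a + k) * ((a - k) * s) ≡ (a - (+ 1 + k)) * (s * (+ 4 * (a * a - k * k)))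
      lemma₂ = solve-∀

    oddRoots-upper : ∀ k → a * oddRoots k y ≡ (a + + k) * shared₁ k
    oddRoots-upper zero    = lemma a
      where
      lemma : ∀ a → a * + 1 ≡ (a + + 0) * + 1
      lemma = solve-∀
    oddRoots-upper (suc k) = begin
      a * ((y - + top k * + top k) * oddRoots k y)  ≡⟨ cong (λ t → a * ((y - t * t) * oddRoots k y)) (+top k) ⟩
      a * ((y - t * t) * oddRoots k y)              ≡⟨ lemma₁ a (+ k) (oddRoots k y) ⟩
      + 4 * (a - + k) * (a + (+ 1 + + k)) * (a * oddRoots k y)  ≡⟨ cong (λ z → + 4 * (a - + k) * (a + (+ 1 + + k)) * z) (oddRoots-upper k) ⟩
      + 4 * (a - + k) * (a + (+ 1 + + k)) * ((a + + k) * shared₁ k)  ≡⟨ lemma₂ a (+ k) (shared₁ k) ⟩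
      (a + + suc k) * (shared₁ k * (+ 4 * (a * a - + k * + k)))  ∎
      where
      open ≡-Reasoning
      t = + 1 + (+ k + + k)
      lemma₁ : ∀ a k z → a * (((+ 2 * a + + 1) * (+ 2 * a + + 1) - (+ 1 + (k + k)) * (+ 1 + (k + k))) * z) ≡ + 4 * (a - k) * (a + (+ 1 + k)) * (a * z)
      lemma₁ = solve-∀
      lemma₂ : ∀ a k s → + 4 * (a - k) * (a + (+ 1 + k)) * ((a + k) * s) ≡ (a + (+ 1 + k)) * (s * (+ 4 * (a * a - k * k)))
      lemma₂ = solve-∀

    evenRoots-lower : ∀ k → + 2 * a * (l * evenRoots₄ k x) ≡ (+ 2 * a - + k) * (l - + k) * shared₂ k
    evenRoots-lower zero    = lemma a
      where
      lemma : ∀ a → + 2 * a * ((+ 2 * a - + 1) * + 1) ≡ (+ 2 * a - + 0) * ((+ 2 * a - + 1) - + 0) * + 1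
      lemma = solve-∀
    evenRoots-lower (suc k) = begin
      + 2 * a * (l * (evenRoots₄ k x * (+ 4 * (x - + suc k * + suc k))))  ≡⟨ lemma₁ a (+ k) (evenRoots₄ k x) ⟩
      + 4 * (x - + suc k * + suc k) * (+ 2 * a * (l * evenRoots₄ k x))    ≡⟨ cong (+ 4 * (x - + suc k * + suc k) *_) (evenRoots-lower k) ⟩
      + 4 * (x - + suc k * + suc k) * ((+ 2 * a - + k) * (l - + k) * shared₂ k)  ≡⟨ lemma₂ a (+ k) (shared₂ k) ⟩
      (+ 2 * a - + suc k) * (l - + suc k) * (shared₂ k * (+ 4 * (+ 4 * (a * a) - + k * + k))) ∎
      where
      open ≡-Reasoning
      lemma₁ : ∀ a k z → + 2 * a * ((+ 2 * a - + 1) * (z * (+ 4 * ((+ 2 * a - + 1) * (+ 2 * a - + 1) - (+ 1 + k) * (+ 1 + k)))))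
        ≡ + 4 * ((+ 2 * a - + 1) * (+ 2 * a - + 1) - (+ 1 + k) * (+ 1 + k)) * (+ 2 * a * ((+ 2 * a - + 1) * z))
      lemma₁ = solve-∀
      lemma₂ : ∀ a k s → + 4 * ((+ 2 * a - + 1) * (+ 2 * a - + 1) - (+ 1 + k) * (+ 1 + k)) * ((+ 2 * a - k) * ((+ 2 * a - + 1) - k) * s)
        ≡ (+ 2 * a - (+ 1 + k)) * ((+ 2 * a - + 1) - (+ 1 + k)) * (s * (+ 4 * (+ 4 * (a * a) - k * k)))
      lemma₂ = solve-∀

    evenRoots-upper : ∀ k → + 2 * a * (u * evenRoots₄ k y) ≡ (+ 2 * a + + k) * (u + + k) * shared₂ k
    evenRoots-upper zero    = lemma a
      where
      lemma : ∀ a → + 2 * a * ((+ 2 * a + + 1) * + 1) ≡ (+ 2 * a + + 0) * ((+ 2 * a + + 1) + + 0) * + 1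
      lemma = solve-∀
    evenRoots-upper (suc k) = begin
      + 2 * a * (u * (evenRoots₄ k y * (+ 4 * (y - + suc k * + suc k))))  ≡⟨ lemma₁ a (+ k) (evenRoots₄ k y) ⟩
      + 4 * (y - + suc k * + suc k) * (+ 2 * a * (u * evenRoots₄ k y))    ≡⟨ cong (+ 4 * (y - + suc k * + suc k) *_) (evenRoots-upper k) ⟩
      + 4 * (y - + suc k * + suc k) * ((+ 2 * a + + k) * (u + + k) * shared₂ k)  ≡⟨ lemma₂ a (+ k) (shared₂ k) ⟩
      (+ 2 * a + + suc k) * (u + + suc k) * (shared₂ k * (+ 4 * (+ 4 * (a * a) - + k * + k))) ∎
      where
      open ≡-Reasoning
      lemma₁ : ∀ a k z → + 2 * a * ((+ 2 * a + + 1) * (z * (+ 4 * ((+ 2 * a + + 1) * (+ 2 * a + + 1) - (+ 1 + k) * (+ 1 + k)))))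
        ≡ + 4 * ((+ 2 * a + + 1) * (+ 2 * a + + 1) - (+ 1 + k) * (+ 1 + k)) * (+ 2 * a * ((+ 2 * a + + 1) * z))
      lemma₁ = solve-∀
      lemma₂ : ∀ a k s → + 4 * ((+ 2 * a + + 1) * (+ 2 * a + + 1) - (+ 1 + k) * (+ 1 + k)) * ((+ 2 * a + k) * ((+ 2 * a + + 1) + k) * s)
        ≡ (+ 2 * a + (+ 1 + k)) * ((+ 2 * a + + 1) + (+ 1 + k)) * (s * (+ 4 * (+ 4 * (a * a) - k * k)))
      lemma₂ = solve-∀

    -- A Wilf-Zeilberger pair with denominators cleared: the right side is the companion term.
    wz : ∀ n → + 4 * (a * a) * (deformed n y * (l * evenRoots₄ n x) - deformed n x * (u * evenRoots₄ n y))
      ≡ - (+ suc n * (+ suc n * central (suc n)) * (shared₁ (suc n) * shared₂ n))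
    wz zero    = lemma a
      where
      lemma : ∀ a → + 4 * (a * a) * (+ 1 * ((+ 2 * a - + 1) * + 1) - + 1 * ((+ 2 * a + + 1) * + 1)) ≡ - (+ 1 * (+ 1 * + 2) * (+ 1 * (+ 4 * (a * a - + 0 * + 0)) * + 1))
      lemma = solve-∀
    wz (suc n) = begin
      + 4 * (a * a) * ((+ 4 * ((y - K) * Uy) + e * Wy) * (l * (Sx * (+ 4 * (x - K)))) - (+ 4 * ((x - K) * Ux) + e * Wx) * (u * (Sy * (+ 4 * (y - K)))))
        ≡⟨ regroup a l u x y K Ux Uy Sx Sy Wx Wy e ⟩
      + 16 * ((x - K) * (y - K)) * (+ 4 * (a * a) * (Uy * (l * Sx) - Ux * (u * Sy)))
        + + 2 * e * (a * Wy * (+ 2 * a * (l * (Sx * (+ 4 * (x - K))))) - a * Wx * (+ 2 * a * (u * (Sy * (+ 4 * (y - K))))))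
        ≡⟨ cong₂ (λ p q → + 16 * ((x - K) * (y - K)) * p + + 2 * e * q) (wz n)
             (cong₂ _-_ (cong₂ _*_ (oddRoots-upper (suc n)) (evenRoots-lower (suc n)))
                        (cong₂ _*_ (oddRoots-lower (suc n)) (evenRoots-upper (suc n)))) ⟩
      + 16 * ((x - K) * (y - K)) * - (+ k * (+ k * central k) * (Y * Z))
        + + 2 * e * ((a + + k) * Y * ((+ 2 * a - + k) * (l - + k) * (Z * (+ 4 * (+ 4 * (a * a) - + n * + n))))
                    - (a - + k) * Y * ((+ 2 * a + + k) * (u + + k) * (Z * (+ 4 * (+ 4 * (a * a) - + n * + n)))))
        -- With the shared products taken out, the induction step is a polynomial identity in a and
        -- n, linear in `central k`, Y and Z.
        ≡⟨ identity a (+ n) (central k) Y Z ⟩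
      - (+ suc k * (+ 2 * (+ 2 * + k + + 1) * central k) * (Y * (+ 4 * (a * a - K)) * (Z * (+ 4 * (+ 4 * (a * a) - + n * + n)))))
        ≡⟨ cong (λ c → - (+ suc k * c * (Y * (+ 4 * (a * a - K)) * (Z * (+ 4 * (+ 4 * (a * a) - + n * + n)))))) (central-suc k) ⟨
      - (+ suc k * (+ suc k * central (suc k)) * (shared₁ (suc k) * shared₂ k)) ∎
      where
      open ≡-Reasoning
      k = suc n
      K = + k * + k
      Ux = deformed n x
      Uy = deformed n y
      Sx = evenRoots₄ n x
      Sy = evenRoots₄ n y
      Wx = oddRoots k x
      Wy = oddRoots k y
      e = coefficient k
      Y = shared₁ k
      Z = shared₂ n
      regroup : ∀ a l u x y K Ux Uy Sx Sy Wx Wy e →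
        + 4 * (a * a) * ((+ 4 * ((y - K) * Uy) + e * Wy) * (l * (Sx * (+ 4 * (x - K)))) - (+ 4 * ((x - K) * Ux) + e * Wx) * (u * (Sy * (+ 4 * (y - K)))))
        ≡ + 16 * ((x - K) * (y - K)) * (+ 4 * (a * a) * (Uy * (l * Sx) - Ux * (u * Sy)))
          + + 2 * e * (a * Wy * (+ 2 * a * (l * (Sx * (+ 4 * (x - K))))) - a * Wx * (+ 2 * a * (u * (Sy * (+ 4 * (y - K))))))
      regroup = solve-∀
      identity : ∀ a n c Y Z →
        + 16 * (((+ 2 * a - + 1) * (+ 2 * a - + 1) - (+ 1 + n) * (+ 1 + n)) * ((+ 2 * a + + 1) * (+ 2 * a + + 1) - (+ 1 + n) * (+ 1 + n))) * - ((+ 1 + n) * ((+ 1 + n) * c) * (Y * Z))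
        + + 2 * ((+ 3 * (+ 1 + n) + + 1) * c) * ((a + (+ 1 + n)) * Y * ((+ 2 * a - (+ 1 + n)) * ((+ 2 * a - + 1) - (+ 1 + n)) * (Z * (+ 4 * (+ 4 * (a * a) - n * n))))
                    - (a - (+ 1 + n)) * Y * ((+ 2 * a + (+ 1 + n)) * ((+ 2 * a + + 1) + (+ 1 + n)) * (Z * (+ 4 * (+ 4 * (a * a) - n * n)))))
        ≡ - ((+ 1 + (+ 1 + n)) * (+ 2 * (+ 2 * (+ 1 + n) + + 1) * c) * (Y * (+ 4 * (a * a - (+ 1 + n) * (+ 1 + n))) * (Z * (+ 4 * (+ 4 * (a * a) - n * n)))))
      identity = solve-∀

  -- Values of the deformed sum at odd squares.

  prod<-≢0 : ∀ n {f} → (∀ i → i < n → f i ≢ + 0) → prod< n f ≢ + 0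
  prod<-≢0 (suc n) {f} f≢0 eq with i*j≡0⇒i≡0∨j≡0 (prod< n f) eq
  ... | inj₁ p≡0 = prod<-≢0 n (λ i i<n → f≢0 i (m<n⇒m<1+n i<n)) p≡0
  ... | inj₂ f≡0 = f≢0 n ≤-refl f≡0

  oddRoots-root : ∀ r n → r < n → oddRoots n (+ top r * + top r) ≡ + 0
  oddRoots-root r (suc n) (s≤s r≤n) with r ℕ.≟ n
  ... | yes refl = vanish (+ top r * + top r) (oddRoots r (+ top r * + top r))
    where
    vanish : ∀ a b → (a - a) * b ≡ + 0
    vanish = solve-∀
  ... | no r≢n = trans (cong ((+ top r * + top r - + top n * + top n) *_) (oddRoots-root r n (ℕₚ.≤∧≢⇒< r≤n r≢n)))
                       (*-zeroʳ (+ top r * + top r - + top n * + top n))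

  n<top : ∀ n → n < top n
  n<top zero    = s≤s z≤n
  n<top (suc n) = s≤s (m<n⇒m<1+n (n<top n))

  -- The roots are the squares of 1, ..., r + 2, all below 2r + 3. This is what permits dividing by
  -- the normalisation of the smaller odd number in the Wilf-Zeilberger relation.
  evenRoots₄-≢0 : ∀ r → evenRoots₄ (suc (suc r)) (+ top (suc r) * + top (suc r)) ≢ + 0
  evenRoots₄-≢0 r = prod<-≢0 (suc (suc r)) factor≢0
    where
    m = top (suc r)
    split : ∀ m j → + 4 * (m * m - j * j) ≡ + 4 * ((m - j) * (m + j))
    split = solve-∀
    factor≢0 : ∀ j → j < suc (suc r) → + 4 * (+ m * + m - + suc j * + suc j) ≢ + 0
    factor≢0 j (s≤s j≤1+r) eq with i*j≡0⇒i≡0∨j≡0 (+ 4) (trans (sym (split (+ m) (+ suc j))) eq)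
    ... | inj₂ eq′ with i*j≡0⇒i≡0∨j≡0 (+ m - + suc j) eq′
    ...   | inj₁ m-j≡0 = ℕₚ.<-irrefl (sym (+-injective (i-j≡0⇒i≡j (+ m) (+ suc j) m-j≡0)))
                            (s≤s (s≤s (ℕₚ.≤-trans j≤1+r (n<top r))))

  -- Once r ≤ n, the new summand contains the root (2r + 1)² and vanishes, so both sides acquire the
  -- same factor. It remains to treat n = r.
  deformed-odd-suc : ∀ r n → deformed n (+ top r * + top r) ≡ + top r * evenRoots₄ n (+ top r * + top r) → r ≤ n →
    deformed (suc n) (+ top r * + top r) ≡ + top r * evenRoots₄ (suc n) (+ top r * + top r)
  deformed-odd-suc r n eq r≤n = begin
    + 4 * ((x - K) * deformed n x) + coefficient (suc n) * oddRoots (suc n) x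
      ≡⟨ cong₂ (λ y z → + 4 * ((x - K) * y) + coefficient (suc n) * z) eq (oddRoots-root r (suc n) (s≤s r≤n)) ⟩
    + 4 * ((x - K) * (+ top r * evenRoots₄ n x)) + coefficient (suc n) * + 0
      ≡⟨ lemma (x - K) (+ top r) (evenRoots₄ n x) (coefficient (suc n)) ⟩
    + top r * evenRoots₄ (suc n) x  ∎
    where
    open ≡-Reasoning
    x = + top r * + top r
    K = + suc n * + suc n
    lemma : ∀ d t e c → + 4 * (d * (t * e)) + c * + 0 ≡ t * (e * (+ 4 * d))
    lemma = solve-∀

  Diagonal : ℕ → Set
  Diagonal r = deformed r (+ top r * + top r) ≡ + top r * evenRoots₄ r (+ top r * + top r)

  -- The companion term at a = n contains the factor a² - n² of `shared₁` and vanishes. Hence the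
  -- normalised values at 2n - 1 and 2n + 1 agree; the former is known from the induction
  -- hypothesis, carried one step further in n, and the nonzero factors `q` and 4a² are cancelled.
  deformed-diagonal-suc : ∀ r → Diagonal (suc r) → Diagonal (suc (suc r))
  deformed-diagonal-suc r ih =
    *-cancelʳ-≡ _ _ q {{≢-nonZero q≢0}} (i-j≡0⇒i≡j _ _ difference≡0)
    where
    open ≡-Reasoning
    n = suc (suc r)
    a = + n
    l = + top (suc r)
    u = + top n
    q = l * evenRoots₄ n (l * l)
    q≢0 : q ≢ + 0
    q≢0 eq with i*j≡0⇒i≡0∨j≡0 l eq
    ... | inj₂ e≡0 = evenRoots₄-≢0 r e≡0
    lower : + 2 * a - + 1 ≡ l
    lower = trans (lemma (+ suc r)) (sym (+top (suc r)))
      where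
      lemma : ∀ r → + 2 * (+ 1 + r) - + 1 ≡ + 1 + (r + r)
      lemma = solve-∀
    upper : + 2 * a + + 1 ≡ u
    upper = trans (lemma a) (sym (+top n))
      where
      lemma : ∀ a → + 2 * a + + 1 ≡ + 1 + (a + a)
      lemma = solve-∀
    wz′ : + 4 * (a * a) * (deformed n (u * u) * q - deformed n (l * l) * (u * evenRoots₄ n (u * u)))
      ≡ - (+ suc n * (+ suc n * central (suc n)) * (shared₁ a (suc n) * shared₂ a n))
    wz′ = subst₂ (λ l u → + 4 * (a * a) * (deformed n (u * u) * (l * evenRoots₄ n (l * l)) - deformed n (l * l) * (u * evenRoots₄ n (u * u)))
      ≡ - (+ suc n * (+ suc n * central (suc n)) * (shared₁ a (suc n) * shared₂ a n))) lower upper (wz a n)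
    vanish : ∀ c p s z → - (c * (p * (+ 4 * (s - s)) * z)) ≡ + 0
    vanish = solve-∀
    swap : ∀ a b c d → a * (b * c) - b * (d * c) ≡ b * (a * c - d * c)
    swap = solve-∀
    difference≡0 : deformed n (u * u) * q - u * evenRoots₄ n (u * u) * q ≡ + 0
    difference≡0 = *-cancelˡ-≡ (+ 4 * (a * a)) _ _ (begin
      + 4 * (a * a) * (deformed n (u * u) * q - u * evenRoots₄ n (u * u) * q)
        ≡⟨ cong (λ z → + 4 * (a * a) * (deformed n (u * u) * q - z)) (comm (u * evenRoots₄ n (u * u)) q) ⟩
      + 4 * (a * a) * (deformed n (u * u) * q - q * (u * evenRoots₄ n (u * u)))
        ≡⟨ cong (λ z → + 4 * (a * a) * (deformed n (u * u) * q - z * (u * evenRoots₄ n (u * u))))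
             (deformed-odd-suc (suc r) (suc r) ih ≤-refl) ⟨
      + 4 * (a * a) * (deformed n (u * u) * q - deformed n (l * l) * (u * evenRoots₄ n (u * u)))
        ≡⟨ wz′ ⟩
      - (+ suc n * (+ suc n * central (suc n)) * (shared₁ a n * (+ 4 * (a * a - a * a)) * shared₂ a n))
        ≡⟨ vanish (+ suc n * (+ suc n * central (suc n))) (shared₁ a n) (a * a) (shared₂ a n) ⟩
      + 0
        ≡⟨ *-zeroʳ (+ 4 * (a * a)) ⟨
      + 4 * (a * a) * + 0 ∎)
      where
      comm : ∀ a b → a * b ≡ b * a
      comm = solve-∀

  deformed-diagonal : ∀ r → Diagonal r
  deformed-diagonal zero          = refl
  -- Computed directly: for m = 1 the product over 1² - j² is zero as soon as n ≥ 1, so the passage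
  -- from m = 1 to m = 3 would divide by zero.
  deformed-diagonal (suc zero)    = refl
  deformed-diagonal (suc (suc r)) = deformed-diagonal-suc r (deformed-diagonal (suc r))

  deformed-odd : ∀ r d → deformed (d ℕ.+ r) (+ top r * + top r) ≡ + top r * evenRoots₄ (d ℕ.+ r) (+ top r * + top r)
  deformed-odd r zero    = deformed-diagonal r
  deformed-odd r (suc d) = deformed-odd-suc r (d ℕ.+ r) (deformed-odd r d) (ℕₚ.m≤n+m r d)

  node-top : ∀ n k → k ≤ n → node n k ≡ + top (n ∸ k)
  node-top n       zero    _         = lemma (+ top n)
    where
    lemma : ∀ t → t - + 2 * + 0 ≡ t
    lemma = solve-∀
  node-top (suc n) (suc k) (s≤s k≤n) = trans (node-suc n k) (node-top n k k≤n)

  deformed-node : ∀ n k → k ≤ n → deformed n (node n k * node n k) ≡ node n k * evenRoots₄ n (node n k * node n k)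
  deformed-node n k k≤n rewrite node-top n k k≤n =
    subst (λ m → deformed m (t * t) ≡ t * evenRoots₄ m (t * t)) (ℕₚ.m+[n∸m]≡n k≤n) (deformed-odd (n ∸ k) k)
    where t = + top (n ∸ k)

  -- The value at 0 and the exact formula for the original sum.

  nodeSum : ℕ → ℤ
  nodeSum n = sum< (suc n) (λ k → weight n k * evenRoots n (node n k * node n k))

  evenRoots₄-evenRoots : ∀ n x → evenRoots₄ n x ≡ (+ 4) ^ n * evenRoots n x
  evenRoots₄-evenRoots n x = trans (prod<-* n (λ _ → + 4) (λ j → x - + suc j * + suc j))
    (cong (_* evenRoots n x) (prod<-const n (+ 4)))

  -- The closed form at a node m carries a factor m, which supplies the one omitted in `cofactor`.
  -- Thus the same odd factorial comes out of every term and the weights reduce to signed binomial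
  -- coefficients.
  deformed-0-nodeSum : ∀ n → evenMass n * deformed n (+ 0) ≡ oddFactorial n * ((+ 4) ^ n * nodeSum n)
  deformed-0-nodeSum n = begin
    evenMass n * deformed n (+ 0)
      ≡⟨ functional-even n (deformed-poly n) ≤-refl ⟨
    functional n (evenWeight n) (deformed n)
      ≡⟨ sum<-cong (suc n) (λ k k<1+n → term k (ℕ.s≤s⁻¹ k<1+n)) ⟩
    sum< (suc n) (λ k → oddFactorial n * ((+ 4) ^ n * (weight n k * evenRoots n (node n k * node n k))))
      ≡⟨ sum<-* (suc n) (oddFactorial n) _ ⟩
    oddFactorial n * sum< (suc n) (λ k → (+ 4) ^ n * (weight n k * evenRoots n (node n k * node n k)))
      ≡⟨ cong (oddFactorial n *_) (sum<-* (suc n) ((+ 4) ^ n) _) ⟩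
    oddFactorial n * ((+ 4) ^ n * nodeSum n) ∎
    where
    open ≡-Reasoning
    lemma : ∀ w c m f e → w * c * (m * (f * e)) ≡ c * m * (f * (w * e))
    lemma = solve-∀
    term : ∀ k → k ≤ n → evenWeight n k * deformed n (node n k * node n k)
      ≡ oddFactorial n * ((+ 4) ^ n * (weight n k * evenRoots n (node n k * node n k)))
    term k k≤n = begin
      evenWeight n k * deformed n x                     ≡⟨ cong (evenWeight n k *_) (deformed-node n k k≤n) ⟩
      evenWeight n k * (node n k * evenRoots₄ n x)      ≡⟨ cong (λ e → evenWeight n k * (node n k * e)) (evenRoots₄-evenRoots n x) ⟩
      weight n k * cofactor n k * (node n k * ((+ 4) ^ n * evenRoots n x))  ≡⟨ lemma (weight n k) (cofactor n k) (node n k) ((+ 4) ^ n) (evenRoots n x) ⟩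
      cofactor n k * node n k * ((+ 4) ^ n * (weight n k * evenRoots n x))  ≡⟨ cong (_* ((+ 4) ^ n * (weight n k * evenRoots n x))) (cofactor-node n k k≤n) ⟩
      oddFactorial n * ((+ 4) ^ n * (weight n k * evenRoots n x)) ∎
      where x = node n k * node n k

  -- The numerator of the original sum over the common denominator 16^n.
  numerator : ℕ → ℤ
  numerator zero    = + 1
  numerator (suc n) = + 16 * numerator n + (+ 3 * + suc n + + 1) * (central (suc n) * central (suc n) * central (suc n))

  fact : ℕ → ℤ
  fact n = + (n !)

  fact-suc : ∀ n → fact (suc n) ≡ + suc n * fact n
  fact-suc n = pos-* (suc n) (n !)

  fact-central-suc : ∀ n → fact (suc n) * central (suc n) ≡ + 2 * (+ 2 * + n + + 1) * (fact n * central n)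
  fact-central-suc n = begin
    fact (suc n) * central (suc n)          ≡⟨ cong (_* central (suc n)) (fact-suc n) ⟩
    + suc n * fact n * central (suc n)      ≡⟨ lemma₁ (+ suc n) (fact n) (central (suc n)) ⟩
    fact n * (+ suc n * central (suc n))    ≡⟨ cong (fact n *_) (central-suc n) ⟩
    fact n * (+ 2 * (+ 2 * + n + + 1) * central n)  ≡⟨ lemma₂ (fact n) (+ n) (central n) ⟩
    + 2 * (+ 2 * + n + + 1) * (fact n * central n)  ∎
    where
    open ≡-Reasoning
    lemma₁ : ∀ a b c → a * b * c ≡ b * (a * c)
    lemma₁ = solve-∀
    lemma₂ : ∀ a n c → a * (+ 2 * (+ 2 * n + + 1) * c) ≡ + 2 * (+ 2 * n + + 1) * (a * c)
    lemma₂ = solve-∀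

  oddRoots-0 : ∀ n → (+ 4) ^ n * oddRoots n (+ 0) ≡ negOnePow n * (fact n * central n * (fact n * central n))
  oddRoots-0 zero    = refl
  oddRoots-0 (suc n) = begin
    + 4 * (+ 4) ^ n * ((+ 0 - + top n * + top n) * oddRoots n (+ 0))
      ≡⟨ cong (λ t → + 4 * (+ 4) ^ n * ((+ 0 - t * t) * oddRoots n (+ 0))) (+top n) ⟩
    + 4 * (+ 4) ^ n * ((+ 0 - t * t) * oddRoots n (+ 0))
      ≡⟨ lemma₁ ((+ 4) ^ n) t (oddRoots n (+ 0)) ⟩
    - (+ 4 * (t * t) * ((+ 4) ^ n * oddRoots n (+ 0)))
      ≡⟨ cong (λ z → - (+ 4 * (t * t) * z)) (oddRoots-0 n) ⟩
    - (+ 4 * (t * t) * (negOnePow n * (f * f)))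
      ≡⟨ lemma₂ (+ n) (negOnePow n) f ⟩
    - negOnePow n * (+ 2 * (+ 2 * + n + + 1) * f * (+ 2 * (+ 2 * + n + + 1) * f))
      ≡⟨ cong (λ z → - negOnePow n * (z * z)) (fact-central-suc n) ⟨
    - negOnePow n * (fact (suc n) * central (suc n) * (fact (suc n) * central (suc n))) ∎
    where
    open ≡-Reasoning
    t = + 1 + (+ n + + n)
    f = fact n * central n
    lemma₁ : ∀ p t z → + 4 * p * ((+ 0 - t * t) * z) ≡ - (+ 4 * (t * t) * (p * z))
    lemma₁ = solve-∀
    lemma₂ : ∀ n s f → - (+ 4 * ((+ 1 + (n + n)) * (+ 1 + (n + n))) * (s * (f * f))) ≡ - s * (+ 2 * (+ 2 * n + + 1) * f * (+ 2 * (+ 2 * n + + 1) * f))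
    lemma₂ = solve-∀

  deformed-0 : ∀ n → (+ 4) ^ n * deformed n (+ 0) ≡ negOnePow n * (fact n * fact n * numerator n)
  deformed-0 zero    = refl
  deformed-0 (suc n) = begin
    + 4 * (+ 4) ^ n * (+ 4 * ((+ 0 - k * k) * deformed n (+ 0)) + e * oddRoots (suc n) (+ 0))
      ≡⟨ lemma₁ ((+ 4) ^ n) k (deformed n (+ 0)) e (oddRoots (suc n) (+ 0)) ⟩
    - (+ 16 * (k * k) * ((+ 4) ^ n * deformed n (+ 0))) + e * (+ 4 * (+ 4) ^ n * oddRoots (suc n) (+ 0))
      ≡⟨ cong₂ (λ y z → - (+ 16 * (k * k) * y) + e * z) (deformed-0 n) (oddRoots-0 (suc n)) ⟩
    - (+ 16 * (k * k) * (s * (fact n * fact n * numerator n))) + e * (- s * (fact (suc n) * c₁ * (fact (suc n) * c₁)))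
      ≡⟨ cong (λ f → - (+ 16 * (k * k) * (s * (fact n * fact n * numerator n))) + e * (- s * (f * c₁ * (f * c₁)))) (fact-suc n) ⟩
    - (+ 16 * (k * k) * (s * (fact n * fact n * numerator n))) + e * (- s * (k * fact n * c₁ * (k * fact n * c₁)))
      ≡⟨ lemma₂ k s (fact n) (numerator n) c₁ ⟩
    - s * (k * fact n * (k * fact n) * (+ 16 * numerator n + (+ 3 * k + + 1) * (c₁ * c₁ * c₁)))
      ≡⟨ cong (λ f → - s * (f * f * numerator (suc n))) (fact-suc n) ⟨
    - s * (fact (suc n) * fact (suc n) * numerator (suc n)) ∎
    where
    open ≡-Reasoning
    k = + suc n
    s = negOnePow n
    c₁ = central (suc n)
    e = coefficient (suc n)
    lemma₁ : ∀ p k u e w → + 4 * p * (+ 4 * ((+ 0 - k * k) * u) + e * w) ≡ - (+ 16 * (k * k) * (p * u)) + e * (+ 4 * p * w)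
    lemma₁ = solve-∀
    lemma₂ : ∀ k s f A c → - (+ 16 * (k * k) * (s * (f * f * A))) + (+ 3 * k + + 1) * c * (- s * (k * f * c * (k * f * c)))
      ≡ - s * (k * f * (k * f) * (+ 16 * A + (+ 3 * k + + 1) * (c * c * c)))
    lemma₂ = solve-∀

  evenMass-fact : ∀ n → evenMass n ≡ negOnePow n * ((+ 8) ^ n * fact n)
  evenMass-fact zero    = refl
  evenMass-fact (suc n) = begin
    - (+ 8 * + suc n) * evenMass n                               ≡⟨ cong (- (+ 8 * + suc n) *_) (evenMass-fact n) ⟩
    - (+ 8 * + suc n) * (negOnePow n * ((+ 8) ^ n * fact n))     ≡⟨ lemma (+ suc n) (negOnePow n) ((+ 8) ^ n) (fact n) ⟩
    - negOnePow n * (+ 8 * (+ 8) ^ n * (+ suc n * fact n))       ≡⟨ cong (λ f → - negOnePow n * (+ 8 * (+ 8) ^ n * f)) (fact-suc n) ⟨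
    - negOnePow n * ((+ 8) ^ suc n * fact (suc n))               ∎
    where
    open ≡-Reasoning
    lemma : ∀ k s e f → - (+ 8 * k) * (s * (e * f)) ≡ - s * (+ 8 * e * (k * f))
    lemma = solve-∀

  negOnePow-square : ∀ n → negOnePow n * negOnePow n ≡ + 1
  negOnePow-square zero    = refl
  negOnePow-square (suc n) = trans (lemma (negOnePow n)) (negOnePow-square n)
    where
    lemma : ∀ s → - s * - s ≡ s * s
    lemma = solve-∀

  -- The outcome of the combinatorial half, valid for every n. The signs of `evenMass` and of the
  -- value at 0 are both (-1)^n and cancel.
  numerator-nodeSum : ∀ n → (+ 8) ^ n * fact n * (fact n * fact n * numerator n)
    ≡ (+ 4) ^ n * ((+ 4) ^ n * (oddFactorial n * nodeSum n))
  numerator-nodeSum n = begin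
    (+ 8) ^ n * fact n * (fact n * fact n * numerator n)
      ≡⟨ lemma₁ ((+ 8) ^ n * fact n) (fact n * fact n * numerator n) ⟩
    + 1 * ((+ 8) ^ n * fact n * (fact n * fact n * numerator n))
      ≡⟨ cong (_* ((+ 8) ^ n * fact n * (fact n * fact n * numerator n))) (negOnePow-square n) ⟨
    s * s * ((+ 8) ^ n * fact n * (fact n * fact n * numerator n))
      ≡⟨ lemma₂ s ((+ 8) ^ n * fact n) (fact n * fact n * numerator n) ⟩
    s * ((+ 8) ^ n * fact n) * (s * (fact n * fact n * numerator n))
      ≡⟨ cong₂ _*_ (evenMass-fact n) (deformed-0 n) ⟨
    evenMass n * ((+ 4) ^ n * deformed n (+ 0))
      ≡⟨ lemma₃ (evenMass n) ((+ 4) ^ n) (deformed n (+ 0)) ⟩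
    (+ 4) ^ n * (evenMass n * deformed n (+ 0))
      ≡⟨ cong ((+ 4) ^ n *_) (deformed-0-nodeSum n) ⟩
    (+ 4) ^ n * (oddFactorial n * ((+ 4) ^ n * nodeSum n))
      ≡⟨ cong ((+ 4) ^ n *_) (lemma₃ (oddFactorial n) ((+ 4) ^ n) (nodeSum n)) ⟩
    (+ 4) ^ n * ((+ 4) ^ n * (oddFactorial n * nodeSum n)) ∎
    where
    open ≡-Reasoning
    s = negOnePow n
    lemma₁ : ∀ a b → a * b ≡ + 1 * (a * b)
    lemma₁ = solve-∀
    lemma₂ : ∀ s a b → s * s * (a * b) ≡ s * a * (s * b)
    lemma₂ = solve-∀
    lemma₃ : ∀ a b c → a * (b * c) ≡ b * (a * c)
    lemma₃ = solve-∀

  -- Parity, signs, factorials and telescoping sums.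

  halves : ∀ N → ∃ λ h → N ≡ h ℕ.+ h ⊎ N ≡ suc (h ℕ.+ h)
  halves zero    = 0 , inj₁ refl
  halves (suc N) with halves N
  ... | h , inj₁ eq = h , inj₂ (cong suc eq)
  ... | h , inj₂ eq = suc h , inj₁ (trans (cong suc eq) (cong suc (sym (ℕₚ.+-suc h h))))

  multiple≅0 : ∀ {M} q → M * q ≅ + 0 [ M ]
  multiple≅0 {M} q = by q (lemma (M * q))
    where
    lemma : ∀ x → x ≡ + 0 + x
    lemma = solve-∀

  zero*≅0 : ∀ {M a} b → a ≅ + 0 [ M ] → a * b ≅ + 0 [ M ]
  zero*≅0 b a≅0 = *-cong-≅ a≅0 (≅-refl {a = b})

  *zero≅0 : ∀ {M b} a → b ≅ + 0 [ M ] → a * b ≅ + 0 [ M ]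
  *zero≅0 a b≅0 = ≅-≡ (*-cong-≅ (≅-refl {a = a}) b≅0) (*-zeroʳ a)

  sum<-≅0 : ∀ {M} m {f} → (∀ i → i < m → f i ≅ + 0 [ M ]) → sum< m f ≅ + 0 [ M ]
  sum<-≅0 m {f} h = ≅-≡ (sum<-cong-≅ m h) (sum<-zero m {λ _ → + 0} λ _ _ → refl)

  sum<-telescope : ∀ N (f : ℕ → ℤ) → sum< N (λ j → f (suc j) - f j) ≡ f N - f 0
  sum<-telescope zero    f = lemma (f 0)
    where
    lemma : ∀ a → + 0 ≡ a - a
    lemma = solve-∀
  sum<-telescope (suc N) f rewrite sum<-telescope N f = lemma (f 0) (f N) (f (suc N))
    where
    lemma : ∀ a b c → b - a + (c - b) ≡ c - a
    lemma = solve-∀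

  power-difference : ∀ m j → (+ suc j) ^ suc m - (+ j) ^ suc m ≡ sum< (suc m) (λ k → c (suc m) k * (+ j) ^ k)
  power-difference m j = begin
    (+ suc j) ^ suc m - (+ j) ^ suc m
      ≡⟨ cong (_- (+ j) ^ suc m) (binomial (suc m) (+ j)) ⟨
    S + c (suc m) (suc m) * (+ j) ^ suc m - (+ j) ^ suc m
      ≡⟨ cong (λ y → S + y * (+ j) ^ suc m - (+ j) ^ suc m) (c-n-n (suc m)) ⟩
    S + + 1 * (+ j) ^ suc m - (+ j) ^ suc m
      ≡⟨ lemma S ((+ j) ^ suc m) ⟩
    S ∎
    where
    open ≡-Reasoning
    S = sum< (suc m) (λ k → c (suc m) k * (+ j) ^ k)
    lemma : ∀ s y → s + + 1 * y - y ≡ s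
    lemma = solve-∀

  neg-^ : ∀ x m → (- x) ^ m ≡ negOnePow m * x ^ m
  neg-^ x zero    = refl
  neg-^ x (suc m) rewrite neg-^ x m = lemma x (negOnePow m) (x ^ m)
    where
    lemma : ∀ x s y → - x * (s * y) ≡ - s * (x * y)
    lemma = solve-∀

  neg-^-even : ∀ x m → negOnePow m ≡ + 1 → (- x) ^ m ≡ x ^ m
  neg-^-even x m even = trans (neg-^ x m) (trans (cong (_* x ^ m) even) (lemma (x ^ m)))
    where
    lemma : ∀ y → + 1 * y ≡ y
    lemma = solve-∀

  negOnePow-±1 : ∀ m → negOnePow m ≡ + 1 ⊎ negOnePow m ≡ - + 1
  negOnePow-±1 zero    = inj₁ refl
  negOnePow-±1 (suc m) with negOnePow-±1 m
  ... | inj₁ eq = inj₂ (cong -_ eq)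
  ... | inj₂ eq = inj₁ (cong -_ eq)

  double-if-even : ∀ j x → + 2 * (if isEven j then x else + 0) ≡ (+ 1 + negOnePow j) * x
  double-if-even zero          x = refl
  double-if-even (suc zero)    x = sym (*-zeroˡ x)
  double-if-even (suc (suc j)) x = trans (double-if-even j x) (lemma (negOnePow j) x)
    where
    lemma : ∀ s x → (+ 1 + s) * x ≡ (+ 1 + - - s) * x
    lemma = solve-∀

  negOnePow-∸ : ∀ m k → k ≤ m → negOnePow (m ∸ k) * negOnePow k ≡ negOnePow m
  negOnePow-∸ m       zero    _         = *-identityʳ (negOnePow m)
  negOnePow-∸ (suc m) (suc k) (s≤s k≤m) = trans (lemma (negOnePow (m ∸ k)) (negOnePow k)) (cong -_ (negOnePow-∸ m k k≤m))
    where
    lemma : ∀ a b → a * - b ≡ - (a * b)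
    lemma = solve-∀

  negOnePow-∸-even : ∀ m k → k ≤ m → negOnePow m ≡ + 1 → negOnePow (m ∸ k) ≡ negOnePow k
  negOnePow-∸-even m k k≤m even with negOnePow-±1 k | negOnePow-∸ m k k≤m
  ... | inj₁ eq | h rewrite eq | even = trans (sym (*-identityʳ _)) h
  ... | inj₂ eq | h rewrite eq | even = trans (lemma (negOnePow (m ∸ k))) (cong -_ h)
    where
    lemma : ∀ a → a ≡ - (a * - + 1)
    lemma = solve-∀

  parity : ℕ → ℤ
  parity k = + 1 + negOnePow k

  -- Doubling replaces the case distinction on parity by the factor 1 + (-1)^k, which the binomial
  -- theorem can absorb by combining x and -x. The index is even, so M - k and k have the same
  -- parity.
  euler-parity : ∀ m → negOnePow (suc (suc m)) ≡ + 1 →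
    + 2 * euler (suc (suc m)) ≡ - sum< (suc (suc m)) (λ k → c (suc (suc m)) k * (parity k * euler k))
  euler-parity m even = begin
    + 2 * euler M                                 ≡⟨ cong (+ 2 *_) (euler-rec m) ⟩
    + 2 * - sum< M (eulerTerm (suc m))            ≡⟨ lemma (sum< M (eulerTerm (suc m))) ⟩
    - (+ 2 * sum< M (eulerTerm (suc m)))          ≡⟨ cong -_ (sum<-* M (+ 2) (eulerTerm (suc m))) ⟨
    - sum< M (λ k → + 2 * eulerTerm (suc m) k)    ≡⟨ cong -_ (sum<-cong M term) ⟩
    - sum< M (λ k → c M k * (parity k * euler k)) ∎
    where
    open ≡-Reasoning
    M = suc (suc m)
    lemma : ∀ x → + 2 * - x ≡ - (+ 2 * x)
    lemma = solve-∀
    swap : ∀ a b d → a * (b * d) ≡ b * (a * d)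
    swap = solve-∀
    term : ∀ k → k < M → + 2 * eulerTerm (suc m) k ≡ c M k * (parity k * euler k)
    term k (s≤s k≤1+m) = begin
      + 2 * eulerTerm (suc m) k
        ≡⟨ double-if-even (M ∸ k) (c M k * eulerTable (suc m) k) ⟩
      (+ 1 + negOnePow (M ∸ k)) * (c M k * eulerTable (suc m) k)
        ≡⟨ cong₂ (λ s e → (+ 1 + s) * (c M k * e)) (negOnePow-∸-even M k (ℕₚ.m≤n⇒m≤1+n k≤1+m) even) (eulerTable-stable (suc m) k k≤1+m) ⟩
      parity k * (c M k * euler k)
        ≡⟨ swap (parity k) (c M k) (euler k) ⟩
      c M k * (parity k * euler k) ∎

  kronecker₀ : ℕ → ℤ
  kronecker₀ zero    = + 1
  kronecker₀ (suc _) = + 0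

  odd : ℕ → ℤ
  odd i = + 1 + + 2 * + i

  alternating-telescope : ∀ N (g : ℕ → ℤ) → sum< N (λ i → negOnePow i * (g (suc i) + g i)) ≡ g 0 - negOnePow N * g N
  alternating-telescope zero    g = lemma (g 0)
    where
    lemma : ∀ a → + 0 ≡ a - + 1 * a
    lemma = solve-∀
  alternating-telescope (suc N) g rewrite alternating-telescope N g = lemma (g 0) (negOnePow N) (g N) (g (suc N))
    where
    lemma : ∀ a s b d → a - s * b + s * (d + b) ≡ a - - s * d
    lemma = solve-∀

  parity-binomial : ∀ m x → sum< (suc m) (λ k → c m k * (parity k * x ^ k)) ≡ (+ 1 + x) ^ m + (+ 1 + - x) ^ m
  parity-binomial m x = begin
    sum< (suc m) (λ k → c m k * (parity k * x ^ k))
      ≡⟨ sum<-cong (suc m) (λ k _ → trans (split (c m k) (negOnePow k) (x ^ k)) (cong (λ y → c m k * x ^ k + c m k * y) (sym (neg-^ x k)))) ⟩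
    sum< (suc m) (λ k → c m k * x ^ k + c m k * (- x) ^ k)
      ≡⟨ sum<-+ (suc m) _ _ ⟩
    sum< (suc m) (λ k → c m k * x ^ k) + sum< (suc m) (λ k → c m k * (- x) ^ k)
      ≡⟨ cong₂ _+_ (binomial m x) (binomial m (- x)) ⟩
    (+ 1 + x) ^ m + (+ 1 + - x) ^ m ∎
    where
    open ≡-Reasoning
    split : ∀ a s y → a * ((+ 1 + s) * y) ≡ a * y + a * (s * y)
    split = solve-∀

  kronecker₀-parity : ∀ m → sum< (suc m) (λ k → c m k * (parity k * kronecker₀ k)) ≡ + 2
  kronecker₀-parity m = trans (sum<-first m _)
    (cong (λ y → + 2 + y) (sum<-zero m λ k _ → lemma (c m (suc k)) (parity (suc k))))
    where
    lemma : ∀ a b → a * (b * + 0) ≡ + 0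
    lemma = solve-∀

  1^ : ∀ m → (+ 1) ^ m ≡ + 1
  1^ zero    = refl
  1^ (suc m) = trans (*-identityˡ _) (1^ m)

  negOnePow-double : ∀ k → negOnePow (k ℕ.+ k) ≡ + 1
  negOnePow-double zero    = refl
  negOnePow-double (suc k) rewrite ℕₚ.+-suc k k = cong (λ s → - - s) (negOnePow-double k)

  *-^ : ∀ x y k → (x * y) ^ k ≡ x ^ k * y ^ k
  *-^ x y zero    = refl
  *-^ x y (suc k) rewrite *-^ x y k = lemma x y (x ^ k) (y ^ k)
    where
    lemma : ∀ x y a b → x * y * (a * b) ≡ x * a * (y * b)
    lemma = solve-∀

  odd-pos : ∀ i → odd i ≡ + suc (i ℕ.+ i)
  odd-pos i = lemma (+ i)
    where
    lemma : ∀ i → + 1 + + 2 * i ≡ + 1 + (i + i)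
    lemma = solve-∀

  fact-prod : ∀ k → fact k ≡ prod< k (λ j → + suc j)
  fact-prod zero    = refl
  fact-prod (suc k) = trans (fact-suc k) (trans (cong (+ suc k *_) (fact-prod k)) (*-comm (+ suc k) _))

  prod<-neg : ∀ N f → prod< N (λ j → - f j) ≡ negOnePow N * prod< N f
  prod<-neg zero    f = refl
  prod<-neg (suc N) f rewrite prod<-neg N f = lemma (negOnePow N) (prod< N f) (f N)
    where
    lemma : ∀ s x y → s * x * - y ≡ - s * (x * y)
    lemma = solve-∀

  fact-double : ∀ k → fact (k ℕ.+ k) ≡ (+ 2) ^ k * (prod< k odd * fact k)
  fact-double zero    = refl
  fact-double (suc k) = begin
    fact (suc (k ℕ.+ suc k))               ≡⟨ cong (λ j → fact (suc j)) (ℕₚ.+-suc k k) ⟩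
    fact (suc (suc (k ℕ.+ k)))             ≡⟨ trans (fact-suc (suc (k ℕ.+ k))) (cong (+ suc (suc (k ℕ.+ k)) *_) (fact-suc (k ℕ.+ k))) ⟩
    + suc (suc (k ℕ.+ k)) * (+ suc (k ℕ.+ k) * fact (k ℕ.+ k))  ≡⟨ cong (λ f → + suc (suc (k ℕ.+ k)) * (+ suc (k ℕ.+ k) * f)) (fact-double k) ⟩
    + suc (suc (k ℕ.+ k)) * (+ suc (k ℕ.+ k) * ((+ 2) ^ k * (prod< k odd * fact k)))  ≡⟨ lemma (+ k) ((+ 2) ^ k) (prod< k odd) (fact k) ⟩
    + 2 * (+ 2) ^ k * (prod< k odd * odd k * (+ suc k * fact k))  ≡⟨ cong (λ f → + 2 * (+ 2) ^ k * (prod< k odd * odd k * f)) (fact-suc k) ⟨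
    (+ 2) ^ suc k * (prod< (suc k) odd * fact (suc k)) ∎
    where
    open ≡-Reasoning
    lemma : ∀ k t d f → (+ 1 + (+ 1 + (k + k))) * ((+ 1 + (k + k)) * (t * (d * f))) ≡ + 2 * t * (d * (+ 1 + + 2 * k) * ((+ 1 + k) * f))
    lemma = solve-∀

  fact-++ : ∀ a b → fact (a ℕ.+ b) ≡ fact a * prod< b (λ i → + suc (a ℕ.+ i))
  fact-++ a b = trans (fact-prod (a ℕ.+ b)) (trans (prod<-++ a b (λ j → + suc j)) (cong (_* prod< b (λ i → + suc (a ℕ.+ i))) (sym (fact-prod a))))

  falling-product : ∀ N a → prod< N (λ j → + suc (a ℕ.+ N) - + suc j) ≡ prod< N (λ i → + suc (a ℕ.+ i))
  falling-product N a = trans (prod<-reverse N _) (prod<-cong N term)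
    where
    lemma : ∀ a i d → + 1 + (a + (i + d)) - (+ 1 + d) ≡ a + i
    lemma = solve-∀
    term : ∀ i → i < N → + suc (a ℕ.+ N) - + suc (N ∸ suc i) ≡ + suc (a ℕ.+ i)
    term i i<N = trans (cong (λ k → + suc (a ℕ.+ k) - + suc (N ∸ suc i)) (sym (ℕₚ.m+[n∸m]≡n i<N)))
      (trans (lemma (+ a) (+ suc i) (+ (N ∸ suc i))) (cong +_ (ℕₚ.+-suc a i)))

  -- x Π_{j ≤ N} (x² - j²) is the product of the 2N + 1 consecutive integers around x.
  consecutive : ∀ N a → + suc (a ℕ.+ N) * evenRoots N (+ suc (a ℕ.+ N) * + suc (a ℕ.+ N))
    ≡ prod< (suc N) (λ i → + suc (a ℕ.+ i)) * prod< N (λ j → + suc (a ℕ.+ N) + + suc j)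
  consecutive N a = begin
    x * evenRoots N (x * x)
      ≡⟨ cong (x *_) (prod<-cong N λ j _ → factor x (+ suc j)) ⟩
    x * prod< N (λ j → (x - + suc j) * (x + + suc j))
      ≡⟨ cong (x *_) (prod<-* N (λ j → x - + suc j) (λ j → x + + suc j)) ⟩
    x * (prod< N (λ j → x - + suc j) * prod< N (λ j → x + + suc j))
      ≡⟨ cong (λ y → x * (y * prod< N (λ j → x + + suc j))) (falling-product N a) ⟩
    x * (prod< N (λ i → + suc (a ℕ.+ i)) * prod< N (λ j → x + + suc j))
      ≡⟨ rotate x (prod< N (λ i → + suc (a ℕ.+ i))) (prod< N (λ j → x + + suc j)) ⟩
    prod< (suc N) (λ i → + suc (a ℕ.+ i)) * prod< N (λ j → x + + suc j) ∎
    where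
    open ≡-Reasoning
    x = + suc (a ℕ.+ N)
    factor : ∀ x y → x * x - y * y ≡ (x - y) * (x + y)
    factor = solve-∀
    rotate : ∀ a b d → a * (b * d) ≡ b * a * d
    rotate = solve-∀

  parity-sum-even : ∀ h (g : ℕ → ℤ) → sum< (h ℕ.+ h) (λ j → parity (suc j) * g (suc j)) ≡ + 2 * sum< h (λ k → g (suc k ℕ.+ suc k))
  parity-sum-even zero    g = refl
  parity-sum-even (suc h) g rewrite ℕₚ.+-suc h h | parity-sum-even h g | negOnePow-double h =
    lemma (sum< h (λ k → g (suc k ℕ.+ suc k))) (g (suc (h ℕ.+ h))) (g (suc (suc (h ℕ.+ h))))
    where
    lemma : ∀ s x y → + 2 * s + + 0 * x + + 2 * y ≡ + 2 * (s + y)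
    lemma = solve-∀

  -- Arithmetic modulo a prime p = 2n + 1 > 3.

  module OddPrime (n : ℕ) (pr : Prime (suc (n ℕ.+ n))) (m : ℕ) (n+n≡3+m : n ℕ.+ n ≡ suc (suc (suc m))) where

    0<n : 0 < n
    0<n = positive n n+n≡3+m
      where
      positive : ∀ n → n ℕ.+ n ≡ suc (suc (suc m)) → 0 < n
      positive (suc n) _ = s≤s z≤n

    p′ : ℕ
    p′ = n ℕ.+ n

    P : ℤ
    P = + suc p′

    natural-unit : ∀ k → suc k < suc p′ → Unit P (+ suc k)
    natural-unit k k<p with coprime-Bézout {suc p′} {suc k} (prime⇒coprime pr k<p)
    ... | Bézout.-+ x y eq = + y , by (+ x) (begin
      + suc k * + y           ≡⟨ pos-* (suc k) y ⟨
      + (suc k ℕ.* y)         ≡⟨ cong +_ (ℕₚ.*-comm (suc k) y) ⟩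
      + (y ℕ.* suc k)         ≡⟨ cong +_ eq ⟨
      + 1 + + (x ℕ.* suc p′)  ≡⟨ cong (λ z → + 1 + + z) (ℕₚ.*-comm x (suc p′)) ⟩
      + 1 + + (suc p′ ℕ.* x)  ≡⟨ cong (λ z → + 1 + z) (pos-* (suc p′) x) ⟩
      + 1 + P * + x           ∎)
      where open ≡-Reasoning
    ... | Bézout.+- x y eq = - + y , by (- + x) (begin
      + suc k * - + y                    ≡⟨ lemma₁ (+ suc k) (+ y) ⟩
      + 1 - (+ 1 + + y * + suc k)        ≡⟨ cong (λ z → + 1 - (+ 1 + z)) (pos-* y (suc k)) ⟨
      + 1 - + (1 ℕ.+ y ℕ.* suc k)        ≡⟨ cong (λ z → + 1 - + z) eq ⟩
      + 1 - + (x ℕ.* suc p′)             ≡⟨ cong (λ z → + 1 - z) (pos-* x (suc p′)) ⟩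
      + 1 - + x * P                      ≡⟨ lemma₂ (+ x) P ⟩
      + 1 + P * - + x                    ∎)
      where
      open ≡-Reasoning
      lemma₁ : ∀ k y → k * - y ≡ + 1 - (+ 1 + y * k)
      lemma₁ = solve-∀
      lemma₂ : ∀ x p → + 1 - x * p ≡ + 1 + p * - x
      lemma₂ = solve-∀

    binomial≅0 : ∀ k → suc k < suc p′ → c (suc p′) (suc k) ≅ + 0 [ P ]
    binomial≅0 k k<p = ≅-cancel₁ (natural-unit k k<p)
      (≡-≅ (c-absorb p′ k) (≅-trans (multiple≅0 (c p′ k)) (≡⇒≅ (sym (*-zeroʳ (+ suc k))))))

    fermat : ∀ x → (+ x) ^ suc p′ ≅ + x [ P ]
    fermat zero    = ≡⇒≅ refl
    fermat (suc x) = ≡-≅ expand (≅-≡ (+-cong-≅ (≅-refl {a = + 1}) (+-cong-≅ middle≅0 last≅x)) (lemma (+ x)))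
      where
      term : ℕ → ℤ
      term k = c (suc p′) k * (+ x) ^ k
      expand : (+ suc x) ^ suc p′ ≡ + 1 + (sum< p′ (λ k → term (suc k)) + term (suc p′))
      expand = trans (sym (binomial (suc p′) (+ x))) (sum<-first (suc p′) term)
      middle≅0 : sum< p′ (λ k → term (suc k)) ≅ + 0 [ P ]
      middle≅0 = sum<-≅0 p′ λ k k<p′ → zero*≅0 ((+ x) ^ suc k) (binomial≅0 k (s≤s k<p′))
      last≅x : term (suc p′) ≅ + x [ P ]
      last≅x = ≡-≅ (trans (cong (_* (+ x) ^ suc p′) (c-n-n (suc p′))) (one* ((+ x) ^ suc p′))) (fermat x)
        where
        one* : ∀ y → + 1 * y ≡ y
        one* = solve-∀
      lemma : ∀ x → + 1 + (+ 0 + x) ≡ + 1 + x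
      lemma = solve-∀

    fermat-unit : ∀ k → suc k < suc p′ → (+ suc k) ^ p′ ≅ + 1 [ P ]
    fermat-unit k k<p = ≅-cancel₁ (natural-unit k k<p)
      (≅-trans (fermat (suc k)) (≡⇒≅ (lemma (+ suc k))))
      where
      lemma : ∀ x → x ≡ x * + 1
      lemma = solve-∀

    -- Power sums modulo p.

    powerSum : ℕ → ℤ
    powerSum m = sum< (suc p′) (λ j → (+ j) ^ m)

    -- Summing (j + 1)^(m + 1) - j^(m + 1) over j < p.
    powerSum-relation : ∀ m → sum< (suc m) (λ k → c (suc m) k * powerSum k) ≡ P ^ suc m
    powerSum-relation m = begin
      sum< (suc m) (λ k → c (suc m) k * powerSum k)
        ≡⟨ sum<-cong (suc m) (λ k _ → sum<-* (suc p′) (c (suc m) k) (λ j → (+ j) ^ k)) ⟨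
      sum< (suc m) (λ k → sum< (suc p′) (λ j → c (suc m) k * (+ j) ^ k))
        ≡⟨ sum<-swap (suc m) (suc p′) (λ k j → c (suc m) k * (+ j) ^ k) ⟩
      sum< (suc p′) (λ j → sum< (suc m) (λ k → c (suc m) k * (+ j) ^ k))
        ≡⟨ sum<-cong (suc p′) (λ j _ → power-difference m j) ⟨
      sum< (suc p′) (λ j → (+ suc j) ^ suc m - (+ j) ^ suc m)
        ≡⟨ sum<-telescope (suc p′) (λ j → (+ j) ^ suc m) ⟩
      P ^ suc m - + 0
        ≡⟨ lemma (P ^ suc m) ⟩
      P ^ suc m ∎
      where
      open ≡-Reasoning
      lemma : ∀ x → x - + 0 ≡ x
      lemma = solve-∀

    -- The relation for exponent m + 1 isolates (m + 1) times the power sum, because the lower ones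
    -- vanish by strong induction; m + 1 < p makes the coefficient a unit.
    powerSum≅0 : ∀ m → m < p′ → powerSum m ≅ + 0 [ P ]
    powerSum≅0 m m<p′ = go (suc m) m ℕₚ.≤-refl m<p′
      where
      go : ∀ N m → m < N → m < p′ → powerSum m ≅ + 0 [ P ]
      go (suc N) m (s≤s m≤N) m<p′ = ≅-cancel₁ (natural-unit m (s≤s m<p′))
        (≡-≅ isolate (≅-≡ (+-cong-≅ (multiple≅0 (P ^ m)) (neg-cong-≅ lower≅0)) (sym (*-zeroʳ (+ suc m)))))
        where
        lower : ℤ
        lower = sum< m (λ k → c (suc m) k * powerSum k)
        lower≅0 : lower ≅ + 0 [ P ]
        lower≅0 = sum<-≅0 m λ k k<m → *zero≅0 (c (suc m) k)
          (go N k (ℕₚ.≤-trans k<m m≤N) (ℕₚ.<-trans k<m m<p′))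
        lemma : ∀ a b → b ≡ a + b + - a
        lemma = solve-∀
        isolate : + suc m * powerSum m ≡ P * P ^ m + - lower
        isolate = trans (cong (_* powerSum m) (sym (c-suc-n m)))
          (trans (lemma lower (c (suc m) m * powerSum m)) (cong (_+ - lower) (powerSum-relation m)))

    reflect : ∀ i → i < n → + suc (n ℕ.+ (n ℕ.∸ suc i)) ≅ - + suc i [ P ]
    reflect i i<n = by (+ 1) (begin
      + suc (n ℕ.+ d)                   ≡⟨ lemma (+ n) (+ d) (+ suc i) ⟩
      - + suc i + + 1 * (+ 1 + (+ n + (+ suc i + + d)))  ≡⟨ cong (λ m → - + suc i + + 1 * (+ 1 + (+ n + + m))) (ℕₚ.m+[n∸m]≡n i<n) ⟩
      - + suc i + + 1 * P               ≡⟨ comm (- + suc i) P ⟩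
      - + suc i + P * + 1               ∎)
      where
      open ≡-Reasoning
      d = n ℕ.∸ suc i
      lemma : ∀ n d i → + 1 + (n + d) ≡ - i + + 1 * (+ 1 + (n + (i + d)))
      lemma = solve-∀
      comm : ∀ a b → a + + 1 * b ≡ a + b * + 1
      comm = solve-∀

    two-unit : Unit P (+ 2)
    two-unit = natural-unit 1 (s≤s (ℕₚ.+-mono-≤ 0<n 0<n))

    -- Even powers do not see the reflection of j to p - j, so the full sum is twice the half sum.
    -- The exponent must be positive for the summand at j = 0 to disappear.
    halfPowerSum≅0 : ∀ m → suc m < p′ → negOnePow (suc m) ≡ + 1 →
      sum< n (λ j → (+ suc j) ^ suc m) ≅ + 0 [ P ]
    halfPowerSum≅0 m m<p′ even = ≅-cancel₁ two-unit
      (≡-≅ (double S) (≅-trans (+-cong-≅ (≅-refl {a = S}) S≅upper)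
        (≡-≅ (sym split) (powerSum≅0 (suc m) m<p′))))
      where
      S upper : ℤ
      S = sum< n (λ j → (+ suc j) ^ suc m)
      upper = sum< n (λ j → (+ suc (n ℕ.+ j)) ^ suc m)
      double : ∀ s → + 2 * s ≡ s + s
      double = solve-∀
      split : powerSum (suc m) ≡ S + upper
      split = trans (sum<-first p′ (λ j → (+ j) ^ suc m))
        (trans (+-identityˡ _) (sum<-++ n n (λ j → (+ suc j) ^ suc m)))
      S≅upper : S ≅ upper [ P ]
      S≅upper = ≅-sym (≡-≅ (sum<-reverse n (λ j → (+ suc (n ℕ.+ j)) ^ suc m))
        (sum<-cong-≅ n λ j j<n → ≅-≡ (^-cong-≅ (suc m) (reflect j j<n)) (neg-^-even (+ suc j) (suc m) even)))

    -- Euler numbers modulo p as alternating power sums.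

    alternatingPower : ℕ → ℤ
    alternatingPower k = sum< n (λ i → negOnePow i * odd i ^ k)

    -- Satisfies the recursion of the Euler numbers modulo p at even indices.
    euler′ : ℕ → ℤ
    euler′ k = + 2 * alternatingPower k + negOnePow n * kronecker₀ k

    -- For y = 2i + 1 and even m the inner sum over k is (y + 1)^m + (y - 1)^m, that is (2i + 2)^m +
    -- (2i)^m, and the alternating sum over i telescopes.
    alternatingPower-parity : ∀ m → negOnePow m ≡ + 1 →
      sum< (suc m) (λ k → c m k * (parity k * alternatingPower k)) ≡ (+ 2 * + 0) ^ m - negOnePow n * (+ 2 * + n) ^ m
    alternatingPower-parity m even = begin
      sum< (suc m) (λ k → c m k * (parity k * alternatingPower k))
        ≡⟨ sum<-cong (suc m) (λ k _ → trans (sym (assoc (c m k) (parity k) (alternatingPower k)))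
             (sym (sum<-* n (c m k * parity k) (λ i → negOnePow i * odd i ^ k)))) ⟩
      sum< (suc m) (λ k → sum< n (λ i → c m k * parity k * (negOnePow i * odd i ^ k)))
        ≡⟨ sum<-swap (suc m) n (λ k i → c m k * parity k * (negOnePow i * odd i ^ k)) ⟩
      sum< n (λ i → sum< (suc m) (λ k → c m k * parity k * (negOnePow i * odd i ^ k)))
        ≡⟨ sum<-cong n (λ i _ → inner i) ⟩
      sum< n (λ i → negOnePow i * (g (suc i) + g i))
        ≡⟨ alternating-telescope n g ⟩
      g 0 - negOnePow n * g n ∎
      where
      open ≡-Reasoning
      g : ℕ → ℤ
      g i = (+ 2 * + i) ^ m
      assoc : ∀ a b d → a * b * d ≡ a * (b * d)
      assoc = solve-∀
      swap : ∀ a b s y → a * b * (s * y) ≡ s * (a * (b * y))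
      swap = solve-∀
      next : ∀ i → + 1 + odd i ≡ + 2 * + suc i
      next i = lemma (+ i)
        where
        lemma : ∀ i → + 1 + (+ 1 + + 2 * i) ≡ + 2 * (+ 1 + i)
        lemma = solve-∀
      previous : ∀ i → + 1 + - odd i ≡ - (+ 2 * + i)
      previous i = lemma (+ i)
        where
        lemma : ∀ i → + 1 + - (+ 1 + + 2 * i) ≡ - (+ 2 * i)
        lemma = solve-∀
      inner : ∀ i → sum< (suc m) (λ k → c m k * parity k * (negOnePow i * odd i ^ k)) ≡ negOnePow i * (g (suc i) + g i)
      inner i = begin
        sum< (suc m) (λ k → c m k * parity k * (negOnePow i * odd i ^ k))
          ≡⟨ sum<-cong (suc m) (λ k _ → swap (c m k) (parity k) (negOnePow i) (odd i ^ k)) ⟩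
        sum< (suc m) (λ k → negOnePow i * (c m k * (parity k * odd i ^ k)))
          ≡⟨ sum<-* (suc m) (negOnePow i) _ ⟩
        negOnePow i * sum< (suc m) (λ k → c m k * (parity k * odd i ^ k))
          ≡⟨ cong (negOnePow i *_) (parity-binomial m (odd i)) ⟩
        negOnePow i * ((+ 1 + odd i) ^ m + (+ 1 + - odd i) ^ m)
          ≡⟨ cong₂ (λ a b → negOnePow i * (a ^ m + b ^ m)) (next i) (previous i) ⟩
        negOnePow i * (g (suc i) + (- (+ 2 * + i)) ^ m)
          ≡⟨ cong (λ b → negOnePow i * (g (suc i) + b)) (neg-^-even (+ 2 * + i) m even) ⟩
        negOnePow i * (g (suc i) + g i) ∎

    2n≅-1 : + 2 * + n ≅ - + 1 [ P ]
    2n≅-1 = by (+ 1) (lemma (+ n))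
      where
      lemma : ∀ n → + 2 * n ≡ - + 1 + (+ 1 + (n + n)) * + 1
      lemma = solve-∀

    -- The telescoped sum leaves a boundary term -(-1)^n (2n)^M with 2n ≡ -1. The summand with
    -- `kronecker₀` in `euler′` is chosen to cancel it, and the same summand makes the value at
    -- index 0 equal to 1.
    euler′-parity : ∀ m → negOnePow (suc m) ≡ + 1 →
      sum< (suc (suc m)) (λ k → c (suc m) k * (parity k * euler′ k)) ≅ + 0 [ P ]
    euler′-parity m even = ≡-≅ expand (≅-≡ (+-cong-≅ (*-cong-≅ (≅-refl {a = + 2}) (+-cong-≅ (≅-refl {a = + 0})
        (neg-cong-≅ (*-cong-≅ (≅-refl {a = s}) power≅1)))) (≅-refl {a = s * + 2})) (cancel s))
      where
      M = suc m
      s = negOnePow n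
      split : ∀ a b x s y → a * (b * (+ 2 * x + s * y)) ≡ + 2 * (a * (b * x)) + s * (a * (b * y))
      split = solve-∀
      cancel : ∀ s → + 2 * (+ 0 + - (s * + 1)) + s * + 2 ≡ + 0
      cancel = solve-∀
      power≅1 : (+ 2 * + n) ^ M ≅ + 1 [ P ]
      power≅1 = ≅-≡ (^-cong-≅ M 2n≅-1) (trans (neg-^-even (+ 1) M even) (1^ M))
      expand : sum< (suc M) (λ k → c M k * (parity k * euler′ k)) ≡ + 2 * (+ 0 + - (s * (+ 2 * + n) ^ M)) + s * + 2
      expand = begin
        sum< (suc M) (λ k → c M k * (parity k * euler′ k))
          ≡⟨ sum<-cong (suc M) (λ k _ → split (c M k) (parity k) (alternatingPower k) s (kronecker₀ k)) ⟩
        sum< (suc M) (λ k → + 2 * (c M k * (parity k * alternatingPower k)) + s * (c M k * (parity k * kronecker₀ k)))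
          ≡⟨ sum<-+ (suc M) _ _ ⟩
        sum< (suc M) (λ k → + 2 * (c M k * (parity k * alternatingPower k))) + sum< (suc M) (λ k → s * (c M k * (parity k * kronecker₀ k)))
          ≡⟨ cong₂ _+_ (sum<-* (suc M) (+ 2) _) (sum<-* (suc M) s _) ⟩
        + 2 * sum< (suc M) (λ k → c M k * (parity k * alternatingPower k)) + s * sum< (suc M) (λ k → c M k * (parity k * kronecker₀ k))
          ≡⟨ cong₂ (λ y z → + 2 * y + s * z) (alternatingPower-parity M even) (kronecker₀-parity M) ⟩
        + 2 * (+ 0 + - (s * (+ 2 * + n) ^ M)) + s * + 2 ∎
        where open ≡-Reasoning

    euler′-0 : euler′ 0 ≡ + 1
    euler′-0 = begin
      + 2 * alternatingPower 0 + s * + 1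
        ≡⟨ cong (_+ s * + 1) (sum<-* n (+ 2) (λ i → negOnePow i * + 1)) ⟨
      sum< n (λ i → + 2 * (negOnePow i * + 1)) + s * + 1
        ≡⟨ cong (_+ s * + 1) (sum<-cong n λ i _ → lemma₁ (negOnePow i)) ⟩
      sum< n (λ i → negOnePow i * (+ 1 + + 1)) + s * + 1
        ≡⟨ cong (_+ s * + 1) (alternating-telescope n (λ _ → + 1)) ⟩
      + 1 - s * + 1 + s * + 1
        ≡⟨ lemma₂ s ⟩
      + 1 ∎
      where
      open ≡-Reasoning
      s = negOnePow n
      lemma₁ : ∀ s → + 2 * (s * + 1) ≡ s * (+ 1 + + 1)
      lemma₁ = solve-∀
      lemma₂ : ∀ s → + 1 - s * + 1 + s * + 1 ≡ + 1
      lemma₂ = solve-∀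

    -- Both sequences satisfy the same recursion with the same initial value. The factor `parity m`
    -- confines the claim to even indices while keeping the induction over all of them, since it is
    -- zero at odd ones.
    euler≅euler′ : ∀ m → parity m * euler m ≅ parity m * euler′ m [ P ]
    euler≅euler′ m = go (suc m) m ℕₚ.≤-refl
      where
      odd-index : ∀ m → negOnePow m ≡ - + 1 → parity m * euler m ≅ parity m * euler′ m [ P ]
      odd-index m eq rewrite eq = ≡⇒≅ (trans (*-zeroˡ (euler m)) (sym (*-zeroˡ (euler′ m))))
      go : ∀ N m → m < N → parity m * euler m ≅ parity m * euler′ m [ P ]
      go (suc N) zero _ = ≡⇒≅ (cong (λ y → + 2 * y) (sym euler′-0))
      go (suc N) (suc zero) _ = odd-index 1 refl
      go (suc N) (suc (suc m)) (s≤s m<N) with negOnePow-±1 (suc (suc m))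
      ... | inj₂ eq = odd-index (suc (suc m)) eq
      ... | inj₁ even = ≡-≅ (trans (cong (λ s → (+ 1 + s) * euler M) even) (euler-parity m even))
        (≅-trans (neg-cong-≅ lower≅) (≅-sym (≡-≅ isolate (≅-≡ (+-cong-≅ (euler′-parity (suc m) even) (≅-refl {a = - lower′})) (+-identityˡ (- lower′))))))
        where
        M = suc (suc m)
        lower′ : ℤ
        lower′ = sum< M (λ k → c M k * (parity k * euler′ k))
        lower≅ : sum< M (λ k → c M k * (parity k * euler k)) ≅ lower′ [ P ]
        lower≅ = sum<-cong-≅ M λ k k<M → *-cong-≅ (≅-refl {a = c M k}) (go N k (ℕₚ.≤-trans k<M m<N))
        lemma : ∀ x y → x ≡ y + + 1 * x + - y
        lemma = solve-∀
        isolate : parity M * euler′ M ≡ sum< (suc M) (λ k → c M k * (parity k * euler′ k)) + - lower′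
        isolate = trans (lemma (parity M * euler′ M) lower′)
          (cong (λ y → lower′ + y * (parity M * euler′ M) + - lower′) (sym (c-n-n M)))

    euler-alternatingPower : ∀ m → negOnePow (suc m) ≡ + 1 → euler (suc m) ≅ + 2 * alternatingPower (suc m) [ P ]
    euler-alternatingPower m even = ≅-cancel₁ two-unit
      (≅-≡ (≡-≅ (cong (λ s → (+ 1 + s) * euler (suc m)) (sym even)) (euler≅euler′ (suc m)))
        (trans (cong (λ s → (+ 1 + s) * euler′ (suc m)) even) (cong (+ 2 *_) (lemma (+ 2 * alternatingPower (suc m)) (negOnePow n)))))
      where
      lemma : ∀ x s → x + s * + 0 ≡ x
      lemma = solve-∀

    -- Inverse squares, and products modulo p³.

    p-3 : ℕ
    -- The parameter m is p - 4, so that p > 3 makes this exponent a visible successor: powers of 0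
    -- vanish and the `kronecker₀` summand drops out.
    p-3 = suc m

    p-3-even : negOnePow p-3 ≡ + 1
    p-3-even = trans (lemma (negOnePow m)) (trans (sym (cong negOnePow n+n≡3+m)) (negOnePow-double n))
      where
      lemma : ∀ s → - s ≡ - - - s
      lemma = solve-∀

    -- Fermat's theorem with two factors split off: the power with exponent p - 3 is the inverse
    -- square.
    square-inverse : ∀ k → suc k < suc p′ → + suc k * + suc k * (+ suc k) ^ p-3 ≅ + 1 [ P ]
    square-inverse k k<p = ≡-≅ (trans (*-assoc (+ suc k) (+ suc k) ((+ suc k) ^ p-3))
      (cong ((+ suc k) ^_) (sym n+n≡3+m))) (fermat-unit k k<p)

    i<n⇒i+i<p′ : ∀ {i} → i < n → i ℕ.+ i < p′
    i<n⇒i+i<p′ i<n = ℕₚ.+-mono-< i<n i<n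

    fact-unit : ∀ k → k ≤ p′ → Unit P (fact k)
    fact-unit k k≤p′ = subst (Unit P) (sym (fact-prod k))
      (prod<-unit k λ j j<k → natural-unit j (s≤s (ℕₚ.≤-trans j<k k≤p′)))

    n≤p′ : n ≤ p′
    n≤p′ = ℕₚ.m≤m+n n n

    -- To second order in P the product only sees the sum of the inverses of its factors.
    prod<-perturb : ∀ N (f g : ℕ → ℤ) → (∀ j → j < N → f j * g j ≅ + 1 [ P ]) →
      prod< N (λ j → f j - P * P) ≅ prod< N f * (+ 1 - P * P * sum< N g) [ P ^ 3 ]
    prod<-perturb zero    f g _  = ≡⇒≅ (lemma (P * P))
      where
      lemma : ∀ q → + 1 ≡ + 1 * (+ 1 - q * + 0)
      lemma = solve-∀
    prod<-perturb (suc N) f g fg with prod<-perturb N f g (λ j j<N → fg j (ℕₚ.m<n⇒m<1+n j<N)) | fg N ℕₚ.≤-refl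
    ... | by q eq | by r fg≡ = by (q * (f N - P * P) + A * P * s + A * r) (begin
      prod< N (λ j → f j - P * P) * (f N - P * P)                    ≡⟨ cong (_* (f N - P * P)) eq ⟩
      (A * (+ 1 - P * P * s) + P ^ 3 * q) * (f N - P * P)            ≡⟨ lemma₁ A P s q (f N) r ⟩
      A * f N * (+ 1 - P * P * s) - P * P * A * (+ 1 + P * r) + P ^ 3 * (q * (f N - P * P) + A * P * s + A * r)
        ≡⟨ cong (λ z → A * f N * (+ 1 - P * P * s) - P * P * A * z + P ^ 3 * (q * (f N - P * P) + A * P * s + A * r)) fg≡ ⟨
      A * f N * (+ 1 - P * P * s) - P * P * A * (f N * g N) + P ^ 3 * (q * (f N - P * P) + A * P * s + A * r)
        ≡⟨ cong (_+ P ^ 3 * (q * (f N - P * P) + A * P * s + A * r)) (lemma₂ A P s (f N) (g N)) ⟩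
      A * f N * (+ 1 - P * P * (s + g N)) + P ^ 3 * (q * (f N - P * P) + A * P * s + A * r) ∎)
      where
      open ≡-Reasoning
      A = prod< N f
      s = sum< N g
      lemma₁ : ∀ A P s q f r → (A * (+ 1 - P * P * s) + (P * (P * (P * + 1))) * q) * (f - P * P)
        ≡ A * f * (+ 1 - P * P * s) - P * P * A * (+ 1 + P * r) + (P * (P * (P * + 1))) * (q * (f - P * P) + A * P * s + A * r)
      lemma₁ = solve-∀
      lemma₂ : ∀ A P s f g → A * f * (+ 1 - P * P * s) - P * P * A * (f * g) ≡ A * f * (+ 1 - P * P * (s + g))
      lemma₂ = solve-∀

    prod<-unperturbed : ∀ N (f g : ℕ → ℤ) → (∀ j → j < N → f j * g j ≅ + 1 [ P ]) → sum< N g ≅ + 0 [ P ] →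
      prod< N (λ j → f j - P * P) ≅ prod< N f [ P ^ 3 ]
    prod<-unperturbed N f g fg (by q eq) = ≅-trans (prod<-perturb N f g fg) (by (- (A * q)) (begin
      A * (+ 1 - P * P * sum< N g)          ≡⟨ cong (λ s → A * (+ 1 - P * P * s)) eq ⟩
      A * (+ 1 - P * P * (+ 0 + P * q))     ≡⟨ lemma A P q ⟩
      A + P ^ 3 * - (A * q)                 ∎))
      where
      open ≡-Reasoning
      A = prod< N f
      lemma : ∀ A P q → A * (+ 1 - P * P * (+ 0 + P * q)) ≡ A + (P * (P * (P * + 1))) * - (A * q)
      lemma = solve-∀

    -- The sum of 1/j² over the half range vanishes modulo p. This removes the p² correction from
    -- the products below, so that they are known modulo p³ and not only modulo p²; it also lets an
    -- alternating sum be replaced by one over even indices.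
    squares≅0 : sum< n (λ j → (+ suc j) ^ p-3) ≅ + 0 [ P ]
    squares≅0 = halfPowerSum≅0 m (subst (suc m <_) (sym n+n≡3+m) (s≤s (ℕₚ.n≤1+n (suc m)))) p-3-even

    evenRoots-P² : evenRoots n (P * P) ≅ negOnePow n * (fact n * fact n) [ P ^ 3 ]
    evenRoots-P² = ≡-≅ signs (*-cong-≅ (≅-refl {a = negOnePow n})
      (≅-≡ (prod<-unperturbed n (λ j → + suc j * + suc j) (λ j → (+ suc j) ^ p-3)
              (λ j j<n → square-inverse j (s≤s (ℕₚ.≤-trans j<n n≤p′))) squares≅0)
        (trans (prod<-* n (λ j → + suc j) (λ j → + suc j)) (sym (cong₂ _*_ (fact-prod n) (fact-prod n))))))
      where
      lemma : ∀ a b → a - b ≡ - (b - a)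
      lemma = solve-∀
      signs : evenRoots n (P * P) ≡ negOnePow n * prod< n (λ j → + suc j * + suc j - P * P)
      signs = trans (prod<-cong n λ j _ → lemma (P * P) (+ suc j * + suc j)) (prod<-neg n _)

    odd-reflect : ∀ i → i < n → odd (n ∸ suc i) ≅ - + 2 * + suc i [ P ]
    odd-reflect i i<n = by (+ 1) (begin
      + 1 + + 2 * + d                                   ≡⟨ lemma (+ d) (+ suc i) ⟩
      - + 2 * + suc i + (+ 1 + ((+ suc i + + d) + (+ suc i + + d))) * + 1
        ≡⟨ cong (λ k → - + 2 * + suc i + (+ 1 + (+ k + + k)) * + 1) (ℕₚ.m+[n∸m]≡n i<n) ⟩
      - + 2 * + suc i + P * + 1 ∎)
      where
      open ≡-Reasoning
      d = n ∸ suc i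
      lemma : ∀ d i → + 1 + + 2 * d ≡ - + 2 * i + (+ 1 + ((i + d) + (i + d))) * + 1
      lemma = solve-∀

    odd-reflect-^ : ∀ i → i < n → odd (n ∸ suc i) ^ p-3 ≅ (+ 2) ^ p-3 * (+ suc i) ^ p-3 [ P ]
    odd-reflect-^ i i<n = ≅-≡ (^-cong-≅ p-3 (odd-reflect i i<n))
      (trans (*-^ (- + 2) (+ suc i) p-3) (cong (_* (+ suc i) ^ p-3) (neg-^-even (+ 2) p-3 p-3-even)))

    oddProduct : ℤ
    oddProduct = prod< n odd

    odd-squares≅0 : sum< n (λ i → odd i ^ p-3) ≅ + 0 [ P ]
    odd-squares≅0 = ≡-≅ (sum<-reverse n (λ i → odd i ^ p-3)) (≅-trans (sum<-cong-≅ n odd-reflect-^)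
      (≡-≅ (sum<-* n ((+ 2) ^ p-3) (λ i → (+ suc i) ^ p-3)) (*zero≅0 ((+ 2) ^ p-3) squares≅0)))

    odd-unit : ∀ i → i < n → Unit P (odd i)
    odd-unit i i<n = subst (Unit P) (sym (odd-pos i)) (natural-unit (i ℕ.+ i) (s≤s (i<n⇒i+i<p′ i<n)))

    upperHalf : prod< n (λ i → + suc (n ℕ.+ i)) ≡ (+ 2) ^ n * oddProduct
    upperHalf = *-cancelˡ-≡ (fact n) _ _ {{n ℕₚ.!≢0}}  (begin
      fact n * prod< n (λ i → + suc (n ℕ.+ i))     ≡⟨ fact-++ n n ⟨
      fact (n ℕ.+ n)                               ≡⟨ fact-double n ⟩
      (+ 2) ^ n * (oddProduct * fact n)            ≡⟨ lemma ((+ 2) ^ n) oddProduct (fact n) ⟩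
      fact n * ((+ 2) ^ n * oddProduct)            ∎)
      where
      open ≡-Reasoning
      lemma : ∀ a b c → a * (b * c) ≡ c * (a * b)
      lemma = solve-∀

    -- An exact evaluation: p - (2i + 1) and p + (2i + 1) are 2(n - i) and 2(n + 1 + i), so the
    -- product is governed by n! and (2n)!/n!, and the latter contains `oddProduct` once. Modulo p³
    -- the same product is the square of `oddProduct`, and comparing the two determines
    -- `oddProduct`.
    odd-squares-P² : prod< n (λ i → odd i * odd i - P * P) ≡ negOnePow n * ((+ 8) ^ n * fact n) * oddProduct
    odd-squares-P² = begin
      prod< n (λ i → odd i * odd i - P * P)
        ≡⟨ prod<-cong n (λ i _ → factor (+ i) (+ n)) ⟩
      prod< n (λ i → - (+ n - + i) * (+ 4 * + suc (n ℕ.+ i)))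
        ≡⟨ prod<-* n _ _ ⟩
      prod< n (λ i → - (+ n - + i)) * prod< n (λ i → + 4 * + suc (n ℕ.+ i))
        ≡⟨ cong₂ _*_ (prod<-neg n (λ i → + n - + i)) (prod<-* n (λ _ → + 4) (λ i → + suc (n ℕ.+ i))) ⟩
      negOnePow n * prod< n (λ i → + n - + i) * (prod< n (λ _ → + 4) * prod< n (λ i → + suc (n ℕ.+ i)))
        ≡⟨ cong₂ (λ f g → negOnePow n * f * (g * prod< n (λ i → + suc (n ℕ.+ i)))) falling (prod<-const n (+ 4)) ⟩
      negOnePow n * fact n * ((+ 4) ^ n * prod< n (λ i → + suc (n ℕ.+ i)))
        ≡⟨ cong (λ u → negOnePow n * fact n * ((+ 4) ^ n * u)) upperHalf ⟩
      negOnePow n * fact n * ((+ 4) ^ n * ((+ 2) ^ n * oddProduct))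
        ≡⟨ lemma (negOnePow n) (fact n) ((+ 4) ^ n) ((+ 2) ^ n) oddProduct ⟩
      negOnePow n * ((+ 4) ^ n * (+ 2) ^ n * fact n) * oddProduct
        ≡⟨ cong (λ x → negOnePow n * (x * fact n) * oddProduct) (*-^ (+ 4) (+ 2) n) ⟨
      negOnePow n * ((+ 8) ^ n * fact n) * oddProduct ∎
      where
      open ≡-Reasoning
      factor : ∀ i n → (+ 1 + + 2 * i) * (+ 1 + + 2 * i) - (+ 1 + (n + n)) * (+ 1 + (n + n)) ≡ - (n - i) * (+ 4 * (+ 1 + (n + i)))
      factor = solve-∀
      lemma : ∀ s f a b d → s * f * (a * (b * d)) ≡ s * (a * b * f) * d
      lemma = solve-∀
      difference : ∀ i → i < n → + n - + (n ∸ suc i) ≡ + suc i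
      difference i i<n = trans (cong (λ k → + k - + (n ∸ suc i)) (sym (ℕₚ.m+[n∸m]≡n i<n))) (cancel (+ suc i) (+ (n ∸ suc i)))
        where
        cancel : ∀ a b → a + b - b ≡ a
        cancel = solve-∀
      falling : prod< n (λ i → + n - + i) ≡ fact n
      falling = trans (prod<-reverse n (λ i → + n - + i)) (trans (prod<-cong n difference) (sym (fact-prod n)))

    -- Morley's congruence in disguise.
    oddProduct≅ : oddProduct ≅ negOnePow n * ((+ 8) ^ n * fact n) [ P ^ 3 ]
    oddProduct≅ = ≅-cancel (prod<-unit n odd-unit) 3
      (≅-sym (≡-≅ (trans (*-comm oddProduct _) (sym odd-squares-P²))
        (≅-≡ (prod<-unperturbed n (λ i → odd i * odd i) (λ i → odd i ^ p-3)
           (λ i i<n → ≡-≅ (cong (λ x → x * x * x ^ p-3) (odd-pos i)) (square-inverse (i ℕ.+ i) (s≤s (i<n⇒i+i<p′ i<n))))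
           odd-squares≅0)
          (prod<-* n odd odd))))

    binomial-sign : ∀ k → k < suc p′ → c p′ k ≅ negOnePow k [ P ]
    binomial-sign zero    _   = ≅-refl
    binomial-sign (suc k) k<p = ≡-≅ (trans (lemma (c p′ k) (c p′ (suc k))) (cong (λ y → y + - c p′ k) (sym (c-pascal p′ k))))
      (≅-≡ (+-cong-≅ (binomial≅0 k k<p) (neg-cong-≅ (binomial-sign k (ℕₚ.<-trans ℕₚ.≤-refl k<p)))) (+-identityˡ (- negOnePow k)))
      where
      lemma : ∀ a b → b ≡ a + b + - a
      lemma = solve-∀

    -- The upper half of the factors is the reflected lower half. The result is expressed by n!²
    -- because that factor is common to all terms of `nodeSum` and is cancelled at the end.
    fact-p′ : fact p′ ≅ negOnePow n * (fact n * fact n) [ P ]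
    fact-p′ = ≡-≅ (fact-++ n n) (≅-≡ (*-cong-≅ (≅-refl {a = fact n})
      (≡-≅ (prod<-reverse n (λ i → + suc (n ℕ.+ i))) (prod<-cong-≅ n reflect)))
      (trans (cong (fact n *_) (trans (prod<-neg n (λ i → + suc i)) (cong (negOnePow n *_) (sym (fact-prod n)))))
        (lemma (fact n) (negOnePow n))))
      where
      lemma : ∀ f s → f * (s * f) ≡ s * (f * f)
      lemma = solve-∀

    -- The terms of the node sum other than the one at m = p.

    module LowerTerm (k a : ℕ) (n≡ : n ≡ suc (k ℕ.+ k) ℕ.+ suc a) where

      -- The parameters encode n = 2K + a, the case 2K ≤ n. Then b + 1 = 2K, and the node is x = p -
      -- 2K = a + n + 1.
      K b : ℕ
      K = suc k
      b = suc (k ℕ.+ k)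

      k<n : k < n
      k<n = subst (k <_) (sym n≡) (s≤s (ℕₚ.≤-trans (ℕₚ.m≤m+n k k) (ℕₚ.m≤m+n (k ℕ.+ k) (suc a))))

      K<p : suc k < suc p′
      K<p = s≤s (ℕₚ.≤-trans k<n n≤p′)

      x : ℤ
      x = + suc (a ℕ.+ n)

      +n : + n ≡ + 1 + (+ k + + k) + (+ 1 + + a)
      +n = cong +_ n≡

      node≡x : node n K ≡ x
      node≡x = trans (cong (_- + 2 * + K) (+top n)) (trans (cong (λ z → + 1 + (z + + n) - + 2 * + K) +n) (lemma (+ k) (+ a) (+ n)))
        where
        lemma : ∀ k a n → + 1 + (+ 1 + (k + k) + (+ 1 + a) + n) - + 2 * (+ 1 + k) ≡ + 1 + (a + n)
        lemma = solve-∀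

      x+b+1 : x + + suc b ≡ P
      x+b+1 = trans (lemma (+ k) (+ a) (+ n)) (cong (λ z → + 1 + (z + + n)) (sym +n))
        where
        lemma : ∀ k a n → + 1 + (a + n) + (+ 1 + (+ 1 + (k + k))) ≡ + 1 + (+ 1 + (k + k) + (+ 1 + a) + n)
        lemma = solve-∀

      x≅ : x ≅ - (+ 2 * + K) [ P ]
      x≅ = by (+ 1) (trans (lemma x (+ k)) (cong (λ z → - (+ 2 * + K) + z * + 1) x+b+1))
        where
        lemma : ∀ x k → x ≡ - (+ 2 * (+ 1 + k)) + (x + (+ 1 + (+ 1 + (k + k)))) * + 1
        lemma = solve-∀

      x-unit : Unit P x
      x-unit = ≅-unit x≅ (neg-unit (*-unit two-unit (natural-unit k K<p)))

      below above : ℤ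
      below = prod< (suc n) (λ i → + suc (a ℕ.+ i)) * prod< b (λ j → x + + suc j)
      above = prod< a (λ j → x + + suc (b ℕ.+ suc j))

      -- The p consecutive integers around x run from a + 1 to a + p and thus contain p exactly
      -- once; `below` and `above` collect those on either side of it.
      x-evenRoots : x * evenRoots n (x * x) ≡ P * (below * above)
      x-evenRoots = begin
        x * evenRoots n (x * x)
          ≡⟨ consecutive n a ⟩
        A * prod< n (λ j → x + + suc j)
          ≡⟨ cong (λ N → A * prod< N (λ j → x + + suc j)) n≡ ⟩
        A * prod< (b ℕ.+ suc a) (λ j → x + + suc j)
          ≡⟨ cong (A *_) (prod<-++ b (suc a) (λ j → x + + suc j)) ⟩
        A * (B * prod< (suc a) (λ j → x + + suc (b ℕ.+ j)))
          ≡⟨ cong (λ y → A * (B * y)) (prod<-first a (λ j → x + + suc (b ℕ.+ j))) ⟩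
        A * (B * ((x + + suc (b ℕ.+ 0)) * above))
          ≡⟨ cong (λ y → A * (B * (y * above))) (trans (cong (λ j → x + + suc j) (ℕₚ.+-identityʳ b)) x+b+1) ⟩
        A * (B * (P * above))
          ≡⟨ rotate A B P above ⟩
        P * (below * above) ∎
        where
        open ≡-Reasoning
        A B : ℤ
        A = prod< (suc n) (λ i → + suc (a ℕ.+ i))
        B = prod< b (λ j → x + + suc j)
        rotate : ∀ a b p d → a * (b * (p * d)) ≡ p * (a * b * d)
        rotate = solve-∀

      fact-below : fact a * below ≡ fact p′
      fact-below = begin
        fact a * (prod< (suc n) (λ i → + suc (a ℕ.+ i)) * prod< b (λ j → x + + suc j))
          ≡⟨ *-assoc (fact a) _ _ ⟨
        fact a * prod< (suc n) (λ i → + suc (a ℕ.+ i)) * prod< b (λ j → x + + suc j)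
          ≡⟨ cong (_* prod< b (λ j → x + + suc j)) (fact-++ a (suc n)) ⟨
        fact (a ℕ.+ suc n) * prod< b (λ j → x + + suc j)
          ≡⟨ cong (fact (a ℕ.+ suc n) *_) (prod<-cong b λ j _ → shift (+ a) (+ n) (+ j)) ⟩
        fact (a ℕ.+ suc n) * prod< b (λ j → + suc ((a ℕ.+ suc n) ℕ.+ j))
          ≡⟨ fact-++ (a ℕ.+ suc n) b ⟨
        fact (a ℕ.+ suc n ℕ.+ b)
          ≡⟨ cong fact index ⟩
        fact p′ ∎
        where
        open ≡-Reasoning
        shift : ∀ a n j → + 1 + (a + n) + (+ 1 + j) ≡ + 1 + ((a + (+ 1 + n)) + j)
        shift = solve-∀
        rearrange : ∀ a n b → a + (+ 1 + n) + b ≡ b + (+ 1 + a) + n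
        rearrange = solve-∀
        index : a ℕ.+ suc n ℕ.+ b ≡ p′
        index = trans (+-injective (rearrange (+ a) (+ n) (+ b))) (cong (ℕ._+ n) (sym n≡))

      above≅ : above ≅ fact a [ P ]
      above≅ = ≅-≡ (prod<-cong-≅ a λ j _ → by (+ 1) (trans (shift x (+ b) (+ j)) (cong (λ z → + suc j + z * + 1) x+b+1)))
        (sym (fact-prod a))
        where
        shift : ∀ x b j → x + (+ 1 + (b + (+ 1 + j))) ≡ + 1 + j + (x + (+ 1 + b)) * + 1
        shift = solve-∀

      -- `below` is (p - 1)!/a!, and the factors p + 1, ..., p + a of `above` give back a! modulo p.
      below-above≅ : below * above ≅ fact p′ [ P ]
      below-above≅ = ≅-≡ (*-cong-≅ (≅-refl {a = below}) above≅) (trans (*-comm below (fact a)) fact-below)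

      evenRoots≅0 : evenRoots n (x * x) ≅ + 0 [ P ]
      evenRoots≅0 = ≅-cancel₁ x-unit (≡-≅ x-evenRoots (≅-≡ (multiple≅0 (below * above)) (sym (*-zeroʳ x))))

      -- Both C(p, K) = pγ and the product over j, pρ, have one factor p, so γ and ρ matter only
      -- modulo p. There Kγ ≡ C(p - 1, k) ≡ (-1)^k and -2Kρ ≡ xρ ≡ (p - 1)!, which explains the
      -- inverse square of K and the factor 2 in the statement.
      lower-term′ : c (suc p′) K ≅ + 0 [ P ] → evenRoots n (x * x) ≅ + 0 [ P ] →
        + 2 * (weight n K * evenRoots n (node n K * node n K)) ≅ P * P * (fact p′ * (+ K) ^ p-3) [ P ^ 3 ]
      lower-term′ (by γ c≡) (by ρ r≡) = subst (λ M → + 2 * (weight n K * evenRoots n (node n K * node n K)) ≅ P * P * (fact p′ * (+ K) ^ p-3) [ M ]) (cube P)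
          (≡-≅ expand (scale-≅ (P * P) core))
        where
        cube : ∀ P → P * P * P ≡ P * (P * (P * + 1))
        cube = solve-∀
        σ : ℤ
        σ = negOnePow k
        expand : + 2 * (weight n K * evenRoots n (node n K * node n K)) ≡ P * P * (+ 2 * (- σ * (γ * ρ)))
        expand = trans (cong₂ (λ u v → + 2 * (- σ * u * v))
            (trans (cong (λ N → c N K) (top-double n)) c≡)
            (trans (cong (λ y → evenRoots n (y * y)) node≡x) r≡))
          (lemma σ P γ ρ)
          where
          lemma : ∀ s p c r → + 2 * (- s * (+ 0 + p * c) * (+ 0 + p * r)) ≡ p * p * (+ 2 * (- s * (c * r)))
          lemma = solve-∀
        Kγ : + K * γ ≅ σ [ P ]
        Kγ = ≡-≅ (*-cancelˡ-≡ P _ _ (trans (lemma (+ K) P γ) (trans (cong (+ K *_) (sym c≡)) (c-absorb p′ k))))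
                 (binomial-sign k (ℕₚ.<-trans ℕₚ.≤-refl K<p))
          where
          lemma : ∀ k p y → p * (k * y) ≡ k * (+ 0 + p * y)
          lemma = solve-∀
        xρ : x * ρ ≅ fact p′ [ P ]
        xρ = ≡-≅ (*-cancelˡ-≡ P _ _ (trans (lemma x P ρ) (trans (cong (x *_) (sym r≡)) x-evenRoots))) below-above≅
          where
          lemma : ∀ k p y → p * (k * y) ≡ k * (+ 0 + p * y)
          lemma = solve-∀
        core : + 2 * (- σ * (γ * ρ)) ≅ fact p′ * (+ K) ^ p-3 [ P ]
        core = ≅-cancel₁ (*-unit (natural-unit k K<p) (natural-unit k K<p))
          (≅-trans (≡-≅ (lemma₁ (+ K) σ γ ρ) (*-cong-≅ (*-cong-≅ (≅-refl {a = σ}) Kγ)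
              (≅-trans (*-cong-≅ (≅-sym x≅) (≅-refl {a = ρ})) xρ)))
            (≅-sym (≡-≅ (lemma₂ (+ K) (fact p′) ((+ K) ^ p-3)) (≅-≡ (*-cong-≅ (≅-refl {a = fact p′}) (square-inverse k K<p))
              (trans (*-comm (fact p′) (+ 1)) (cong (_* fact p′) (sym (negOnePow-square k))))))))
          where
          lemma₁ : ∀ k s c r → k * k * (+ 2 * (- s * (c * r))) ≡ s * (k * c) * (- (+ 2 * k) * r)
          lemma₁ = solve-∀
          lemma₂ : ∀ k f y → k * k * (f * y) ≡ f * (k * k * y)
          lemma₂ = solve-∀

      lower-term : + 2 * (weight n K * evenRoots n (node n K * node n K)) ≅ P * P * (fact p′ * (+ K) ^ p-3) [ P ^ 3 ]
      lower-term = lower-term′ (binomial≅0 k K<p) evenRoots≅0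

    -- The node p - 2K is then an odd number at most n, so its square is one of the roots j².
    upper-term : ∀ k → k < n → n < suc k ℕ.+ suc k → weight n (suc k) * evenRoots n (node n (suc k) * node n (suc k)) ≡ + 0
    upper-term k k<n n<2K = trans (cong (weight n (suc k) *_) (prod<-zero n j j<n factor≡0)) (*-zeroʳ (weight n (suc k)))
      where
      j : ℕ
      j = (n ∸ suc k) ℕ.+ (n ∸ suc k)
      node≡ : node n (suc k) ≡ + suc j
      node≡ = trans (node-top n (suc k) k<n) (cong +_ (top-double (n ∸ suc k)))
      vanish : ∀ x → x - x ≡ + 0
      vanish = solve-∀
      factor≡0 : node n (suc k) * node n (suc k) - + suc j * + suc j ≡ + 0
      factor≡0 = trans (cong (λ y → y * y - + suc j * + suc j) node≡) (vanish (+ suc j * + suc j))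
      j<n : j < n
      j<n = ℕₚ.+-cancelˡ-< (suc k ℕ.+ suc k) j n (subst (ℕ._< suc k ℕ.+ suc k ℕ.+ n) (sym total) (ℕₚ.+-monoˡ-< n n<2K))
        where
        rearrange : ∀ x d → (x + x) + (d + d) ≡ (x + d) + (x + d)
        rearrange = solve-∀
        total : suc k ℕ.+ suc k ℕ.+ j ≡ n ℕ.+ n
        total = trans (+-injective (rearrange (+ suc k) (+ (n ∸ suc k)))) (cong₂ ℕ._+_ (ℕₚ.m+[n∸m]≡n k<n) (ℕₚ.m+[n∸m]≡n k<n))

    -- Summation over K ≤ n/2 and the appearance of the Euler number.

    half : ℕ
    half = proj₁ (halves n)

    half+half≤n : half ℕ.+ half ≤ n
    half+half≤n with halves n
    ... | h , inj₁ eq = ℕₚ.≤-reflexive (sym eq)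
    ... | h , inj₂ eq = ℕₚ.≤-trans (ℕₚ.n≤1+n (h ℕ.+ h)) (ℕₚ.≤-reflexive (sym eq))

    n≤1+half+half : n ≤ suc (half ℕ.+ half)
    n≤1+half+half with halves n
    ... | h , inj₁ eq = ℕₚ.≤-trans (ℕₚ.≤-reflexive eq) (ℕₚ.n≤1+n (h ℕ.+ h))
    ... | h , inj₂ eq = ℕₚ.≤-reflexive eq

    half≤n : half ≤ n
    half≤n = ℕₚ.≤-trans (ℕₚ.m≤m+n half half) half+half≤n

    parity-sum : ∀ (g : ℕ → ℤ) → sum< n (λ j → parity (suc j) * g (suc j)) ≡ + 2 * sum< half (λ k → g (suc k ℕ.+ suc k))
    parity-sum g with halves n
    ... | h , inj₁ eq = trans (cong (λ N → sum< N (λ j → parity (suc j) * g (suc j))) eq) (parity-sum-even h g)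
    ... | h , inj₂ eq = trans (cong (λ N → sum< N (λ j → parity (suc j) * g (suc j))) eq)
      (trans (cong₂ _+_ (parity-sum-even h g) (cong (λ s → (+ 1 + - s) * g (suc (h ℕ.+ h))) (negOnePow-double h)))
        (lemma (sum< h (λ k → g (suc k ℕ.+ suc k))) (g (suc (h ℕ.+ h)))))
      where
      lemma : ∀ s x → + 2 * s + + 0 * x ≡ + 2 * s
      lemma = solve-∀

    -- Modulo p, the sum of 1/K² over 1 ≤ K ≤ n/2.
    H : ℤ
    H = sum< half (λ k → (+ suc k) ^ p-3)

    term : ℕ → ℤ
    term k = weight n k * evenRoots n (node n k * node n k)

    doubled-terms : + 2 * sum< n (λ k → term (suc k)) ≅ P * P * (fact p′ * H) [ P ^ 3 ]
    doubled-terms = ≡-≅ (trans (cong (+ 2 *_) truncate) (sym (sum<-* half (+ 2) (λ k → term (suc k)))))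
      (≅-≡ (sum<-cong-≅ half lower)
        (trans (sum<-* half (P * P) _) (cong (P * P *_) (sum<-* half (fact p′) _))))
      where
      open ≡-Reasoning
      truncate : sum< n (λ k → term (suc k)) ≡ sum< half (λ k → term (suc k))
      truncate = begin
        sum< n (λ k → term (suc k))
          ≡⟨ cong (λ N → sum< N (λ k → term (suc k))) (ℕₚ.m+[n∸m]≡n half≤n) ⟨
        sum< (half ℕ.+ (n ∸ half)) (λ k → term (suc k))
          ≡⟨ sum<-++ half (n ∸ half) (λ k → term (suc k)) ⟩
        sum< half (λ k → term (suc k)) + sum< (n ∸ half) (λ i → term (suc (half ℕ.+ i)))
          ≡⟨ cong (λ y → sum< half (λ k → term (suc k)) + y) (sum<-zero (n ∸ half) upper) ⟩
        sum< half (λ k → term (suc k)) + + 0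
          ≡⟨ +-identityʳ _ ⟩
        sum< half (λ k → term (suc k)) ∎
        where
        upper : ∀ i → i < n ∸ half → term (suc (half ℕ.+ i)) ≡ + 0
        upper i i<d = upper-term (half ℕ.+ i)
          (subst (half ℕ.+ i <_) (ℕₚ.m+[n∸m]≡n half≤n) (ℕₚ.+-monoʳ-< half i<d))
          (ℕₚ.≤-trans (s≤s n≤1+half+half) (ℕₚ.≤-trans (ℕₚ.≤-reflexive (cong suc (sym (ℕₚ.+-suc half half))))
            (ℕₚ.+-mono-≤ (s≤s (ℕₚ.m≤m+n half i)) (s≤s (ℕₚ.m≤m+n half i)))))
      lower : ∀ k → k < half → + 2 * term (suc k) ≅ P * P * (fact p′ * (+ suc k) ^ p-3) [ P ^ 3 ]
      lower k k<h = LowerTerm.lower-term k (n ∸ (suc k ℕ.+ suc k)) (trans (sym (ℕₚ.m+[n∸m]≡n 2K≤n))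
          (trans (cong (ℕ._+ (n ∸ (suc k ℕ.+ suc k))) (cong suc (ℕₚ.+-suc k k))) (sym (ℕₚ.+-suc (suc (k ℕ.+ k)) _))))
        where
        2K≤n : suc k ℕ.+ suc k ≤ n
        2K≤n = ℕₚ.≤-trans (ℕₚ.+-mono-≤ k<h k<h) half+half≤n

    two-e : ℤ
    two-e = (+ 2) ^ p-3

    four-two-e : + 4 * two-e ≅ + 1 [ P ]
    four-two-e = square-inverse 1 (s≤s (ℕₚ.+-mono-≤ 0<n 0<n))

    -- Reading the odd numbers from the top, p - 2j ≡ -2j, turns them into multiples of all j ≤ n
    -- with alternating signs. Adding the vanishing sum of the 1/j² leaves twice the terms with even
    -- j, and the 2 in j = 2K gives the second factor `two-e`.
    alternating-half : alternatingPower p-3 ≅ negOnePow n * (two-e * (+ 2 * (two-e * H))) [ P ]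
    alternating-half = ≡-≅ (sum<-reverse n (λ i → negOnePow i * odd i ^ p-3))
      (≅-trans (sum<-cong-≅ n reflected)
      (≡-≅ (trans (sum<-* n (negOnePow n) _) (cong (negOnePow n *_) (sum<-* n two-e (λ j → negOnePow (suc j) * (+ suc j) ^ p-3))))
      (*-cong-≅ (≅-refl {a = negOnePow n}) (*-cong-≅ (≅-refl {a = two-e}) signed))))
      where
      sign : ∀ j → j < n → negOnePow (n ∸ suc j) ≡ negOnePow n * negOnePow (suc j)
      sign j j<n = trans (sym (*-identityʳ _)) (trans (cong (negOnePow (n ∸ suc j) *_) (sym (negOnePow-square (suc j))))
        (trans (sym (*-assoc (negOnePow (n ∸ suc j)) (negOnePow (suc j)) (negOnePow (suc j))))
          (cong (_* negOnePow (suc j)) (negOnePow-∸ n (suc j) j<n))))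
      rearrange : ∀ s t a b → s * t * (a * b) ≡ s * (a * (t * b))
      rearrange = solve-∀
      reflected : ∀ j → j < n → negOnePow (n ∸ suc j) * odd (n ∸ suc j) ^ p-3 ≅ negOnePow n * (two-e * (negOnePow (suc j) * (+ suc j) ^ p-3)) [ P ]
      reflected j j<n = ≅-≡ (*-cong-≅ (≡⇒≅ (sign j j<n)) (odd-reflect-^ j j<n)) (rearrange (negOnePow n) (negOnePow (suc j)) two-e ((+ suc j) ^ p-3))
      signed : sum< n (λ j → negOnePow (suc j) * (+ suc j) ^ p-3) ≅ + 2 * (two-e * H) [ P ]
      signed = ≅-trans (≡-≅ (sym (+-identityˡ _)) (+-cong-≅ (≅-sym squares≅0) (≅-refl {a = sum< n (λ j → negOnePow (suc j) * (+ suc j) ^ p-3)})))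
        (≡⇒≅ (begin
          sum< n (λ j → (+ suc j) ^ p-3) + sum< n (λ j → negOnePow (suc j) * (+ suc j) ^ p-3)
            ≡⟨ sum<-+ n _ _ ⟨
          sum< n (λ j → (+ suc j) ^ p-3 + negOnePow (suc j) * (+ suc j) ^ p-3)
            ≡⟨ sum<-cong n (λ j _ → collect (negOnePow (suc j)) ((+ suc j) ^ p-3)) ⟩
          sum< n (λ j → parity (suc j) * (+ suc j) ^ p-3)
            ≡⟨ parity-sum (λ j → (+ j) ^ p-3) ⟩
          + 2 * sum< half (λ k → (+ (suc k ℕ.+ suc k)) ^ p-3)
            ≡⟨ cong (+ 2 *_) (sum<-cong half λ k _ → trans (cong (_^ p-3) (twice (+ suc k))) (*-^ (+ 2) (+ suc k) p-3)) ⟩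
          + 2 * sum< half (λ k → two-e * (+ suc k) ^ p-3)
            ≡⟨ cong (+ 2 *_) (sum<-* half two-e _) ⟩
          + 2 * (two-e * H) ∎))
        where
        open ≡-Reasoning
        collect : ∀ s y → y + s * y ≡ (+ 1 + s) * y
        collect = solve-∀
        twice : ∀ x → x + x ≡ + 2 * x
        twice = solve-∀

    euler-half : + 4 * euler p-3 ≅ negOnePow n * H [ P ]
    euler-half = ≅-cancel₁ two-unit (≅-cancel₁ two-unit
      -- `two-e` stands for 1/4 and occurs twice. Multiplying the claim by 4 produces the factor 16
      -- that turns both occurrences into `four-two-e`.
      (≡-≅ (lemma₀ (euler p-3)) (≅-trans (*-cong-≅ (≅-refl {a = + 16}) (≅-trans (euler-alternatingPower m p-3-even) (*-cong-≅ (≅-refl {a = + 2}) alternating-half)))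
        (≡-≅ (lemma₁ (negOnePow n) two-e H) (≅-≡ (*-cong-≅ (*-cong-≅ four-two-e four-two-e) (≅-refl {a = + 4 * (negOnePow n * H)})) (lemma₂ (negOnePow n * H)))))))
      where
      lemma₀ : ∀ x → + 2 * (+ 2 * (+ 4 * x)) ≡ + 16 * x
      lemma₀ = solve-∀
      lemma₁ : ∀ s t h → + 16 * (+ 2 * (s * (t * (+ 2 * (t * h))))) ≡ + 4 * t * (+ 4 * t) * (+ 4 * (s * h))
      lemma₁ = solve-∀
      lemma₂ : ∀ x → + 1 * + 1 * (+ 4 * x) ≡ + 2 * (+ 2 * x)
      lemma₂ = solve-∀

    -- The sum is doubled to match `doubled-terms`. The remaining terms carry p², so (p - 1)! and
    -- `H` are needed only modulo p; their signs (-1)^n cancel, in contrast to the main term, and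
    -- this is the source of the Legendre symbol in the result.
    nodeSum≅ : nodeSum n ≅ negOnePow n * (fact n * fact n) + + 2 * (P * P) * (fact n * fact n * euler p-3) [ P ^ 3 ]
    nodeSum≅ = ≅-cancel two-unit 3 (≡-≅ expand (≅-≡ (+-cong-≅ (*-cong-≅ (≅-refl {a = + 2}) evenRoots-P²) (≅-trans doubled-terms correction)) (lemma s F (P * P) (euler p-3))))
      where
      s F : ℤ
      s = negOnePow n
      F = fact n * fact n
      expand : + 2 * nodeSum n ≡ + 2 * evenRoots n (P * P) + + 2 * sum< n (λ k → term (suc k))
      expand = trans (cong (+ 2 *_) (trans (sum<-first n term) (cong (λ y → y + sum< n (λ k → term (suc k))) first)))
        (distrib (evenRoots n (P * P)) _)
        where
        distrib : ∀ a b → + 2 * (a + b) ≡ + 2 * a + + 2 * b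
        distrib = solve-∀
        node0 : node n 0 ≡ P
        node0 = trans (cong (_- + 2 * + 0) (+top n)) (drop P)
          where
          drop : ∀ x → x - + 2 * + 0 ≡ x
          drop = solve-∀
        first : term 0 ≡ evenRoots n (P * P)
        first = trans (*-identityˡ _) (cong (λ y → evenRoots n (y * y)) node0)
      cube : ∀ P → P * P * P ≡ P * (P * (P * + 1))
      cube = solve-∀
      correction : P * P * (fact p′ * H) ≅ P * P * (F * (+ 4 * euler p-3)) [ P ^ 3 ]
      correction = subst (λ M → P * P * (fact p′ * H) ≅ P * P * (F * (+ 4 * euler p-3)) [ M ]) (cube P)
        (scale-≅ (P * P) (≅-trans (*-cong-≅ fact-p′ (≅-refl {a = H})) (≡-≅ (rearrange s F H) (*-cong-≅ (≅-refl {a = F}) (≅-sym euler-half)))))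
        where
        rearrange : ∀ s f h → s * f * h ≡ f * (s * h)
        rearrange = solve-∀
      lemma : ∀ s f q y → + 2 * (s * f) + q * (f * (+ 4 * y)) ≡ + 2 * (s * f + + 2 * q * (f * y))
      lemma = solve-∀

    -- The congruence for the numerator modulo p⁴.

    target : ℤ
    target = P + + 2 * negOnePow n * P ^ 3 * euler p-3

    numerator≅ : numerator n ≅ (+ 16) ^ n * target [ P ^ 4 ]
    numerator≅ = ≅-cancel F-unit 4 (≅-cancel E-unit 4 (≡-≅ (numerator-nodeSum n)
      -- The last factor of `oddFactorial n` is p itself. Splitting it off raises the modulus of the
      -- two congruences modulo p³ to p⁴, and the sign (-1)^n from `oddProduct≅` removes that of the
      -- main term.
      (≡-≅ regroup (≅-≡ (*-cong-≅ (≅-refl {a = (+ 16) ^ n}) (scale-≅ P (*-cong-≅ oddProduct≅ nodeSum≅))) final))))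
      where
      s F E : ℤ
      s = negOnePow n
      F = fact n * fact n
      E = (+ 8) ^ n * fact n
      F-unit : Unit P F
      F-unit = *-unit (fact-unit n n≤p′) (fact-unit n n≤p′)
      E-unit : Unit P E
      E-unit = *-unit (^-unit n (eight-unit two-unit)) (fact-unit n n≤p′)
        where
        eight-unit : Unit P (+ 2) → Unit P (+ 8)
        eight-unit u = *-unit u (*-unit u u)
      oddFactorial-product : ∀ k → oddFactorial k ≡ prod< k odd * + top k
      oddFactorial-product zero    = refl
      oddFactorial-product (suc k) = cong (_* + top (suc k)) (trans (oddFactorial-product k)
        (cong (prod< k odd *_) (trans (+top k) (lemma (+ k)))))
        where
        lemma : ∀ k → + 1 + (k + k) ≡ + 1 + + 2 * k
        lemma = solve-∀
      regroup : (+ 4) ^ n * ((+ 4) ^ n * (oddFactorial n * nodeSum n)) ≡ (+ 16) ^ n * (P * (oddProduct * nodeSum n))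
      regroup = trans (cong (λ y → (+ 4) ^ n * ((+ 4) ^ n * (y * nodeSum n))) (trans (oddFactorial-product n) (cong (oddProduct *_) (+top n))))
        (trans (lemma ((+ 4) ^ n) oddProduct P (nodeSum n)) (cong (_* (P * (oddProduct * nodeSum n))) (sym (*-^ (+ 4) (+ 4) n))))
        where
        lemma : ∀ f d p b → f * (f * (d * p * b)) ≡ f * f * (p * (d * b))
        lemma = solve-∀
      final : (+ 16) ^ n * (P * (s * E * (s * F + + 2 * (P * P) * (F * euler p-3)))) ≡ E * (F * ((+ 16) ^ n * target))
      final = trans (lemma₁ ((+ 16) ^ n) P s E F (euler p-3))
        (trans (cong (λ y → E * (F * ((+ 16) ^ n * (P * y + + 2 * s * (P * (P * (P * + 1))) * euler p-3)))) (negOnePow-square n))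
          (cong (λ y → E * (F * ((+ 16) ^ n * (y + + 2 * s * P ^ 3 * euler p-3)))) (*-identityʳ P)))
        where
        lemma₁ : ∀ x p s E F y → x * (p * (s * E * (s * F + + 2 * (p * p) * (F * y)))) ≡ E * (F * (x * (p * (s * s) + + 2 * s * (p * (p * (p * + 1))) * y)))
        lemma₁ = solve-∀

-- Rational numbers represented by fractions not necessarily in lowest terms.

module Fractions where

  open import Data.Integer using (_+_; _*_; -_)
  open import Data.Integer.GCD using (gcd)

  -- x = a / d, without requiring lowest terms.
  record Represents (x : ℚ) (a d : ℤ) : Set where
    constructor represents
    field
      cross : ↥ x * d ≡ a * ↧ x

  represents-/ : ∀ a d .{{_ : ℕ.NonZero d}} → Represents (a ℚ./ d) a (+ d)
  represents-/ a d = represents (begin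
    ↥ x * + d                    ≡⟨ cong (↥ x *_) (↧-/ a d) ⟨
    ↥ x * (↧ x * gcd a (+ d))    ≡⟨ lemma (↥ x) (↧ x) (gcd a (+ d)) ⟩
    ↥ x * gcd a (+ d) * ↧ x      ≡⟨ cong (_* ↧ x) (↥-/ a d) ⟩
    a * ↧ x                      ∎)
    where
    open ≡-Reasoning
    x = a ℚ./ d
    lemma : ∀ u l g → u * (l * g) ≡ u * g * l
    lemma = solve-∀

  represents-scale : ∀ {x a d} k → Represents x a d → Represents x (k * a) (k * d)
  represents-scale {x} {a} {d} k (represents r) =
    represents (trans (lemma₁ (↥ x) k d) (trans (cong (k *_) r) (lemma₂ k a (↧ x))))
    where
    lemma₁ : ∀ u k d → u * (k * d) ≡ k * (u * d)
    lemma₁ = solve-∀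
    lemma₂ : ∀ k a l → k * (a * l) ≡ k * a * l
    lemma₂ = solve-∀

  represents-neg : ∀ {x a d} → Represents x a d → Represents (ℚ.- x) (- a) d
  represents-neg {x} {a} {d} (represents r) = represents (begin
    ↥ (ℚ.- x) * d     ≡⟨ cong (_* d) (↥-neg x) ⟩
    - ↥ x * d         ≡⟨ lemma₁ (↥ x) d ⟩
    - (↥ x * d)       ≡⟨ cong -_ r ⟩
    - (a * ↧ x)       ≡⟨ lemma₂ a (↧ x) ⟩
    - a * ↧ x         ≡⟨ cong (- a *_) (↧-neg x) ⟨
    - a * ↧ (ℚ.- x)   ∎)
    where
    open ≡-Reasoning
    lemma₁ : ∀ u d → - u * d ≡ - (u * d)
    lemma₁ = solve-∀
    lemma₂ : ∀ a l → - (a * l) ≡ - a * l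
    lemma₂ = solve-∀

  -- The factor lost when a sum of rationals is normalised; it must be nonzero to be cancelled from
  -- the cross-multiplied equation.
  +-gcd : ℚ → ℚ → ℤ
  +-gcd x y = gcd (↥ x * ↧ y + ↥ y * ↧ x) (↧ x * ↧ y)

  +-gcd≢0 : ∀ x y → +-gcd x y ≢ + 0
  +-gcd≢0 x y g≡0 with i*j≡0⇒i≡0∨j≡0 (↧ x) {↧ y}
    (trans (sym (↧-+ x y)) (trans (cong (↧ (x ℚ.+ y) *_) g≡0) (*-zeroʳ (↧ (x ℚ.+ y)))))
  ... | inj₁ ()
  ... | inj₂ ()

  represents-+ : ∀ {x y a b d} → Represents x a d → Represents y b d → Represents (x ℚ.+ y) (a + b) d
  represents-+ {x} {y} {a} {b} {d} (represents r) (represents s) = represents (*-cancelʳ-≡ _ _ g {{≢-nonZero (+-gcd≢0 x y)}} (begin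
    ↥ z * d * g                              ≡⟨ lemma₁ (↥ z) d g ⟩
    ↥ z * g * d                              ≡⟨ cong (_* d) (↥-+ x y) ⟩
    (↥ x * ↧ y + ↥ y * ↧ x) * d              ≡⟨ lemma₂ (↥ x) (↥ y) (↧ x) (↧ y) d ⟩
    ↥ x * d * ↧ y + ↥ y * d * ↧ x            ≡⟨ cong₂ (λ u v → u * ↧ y + v * ↧ x) r s ⟩
    a * ↧ x * ↧ y + b * ↧ y * ↧ x            ≡⟨ lemma₃ a b (↧ x) (↧ y) ⟩
    (a + b) * (↧ x * ↧ y)                    ≡⟨ cong ((a + b) *_) (↧-+ x y) ⟨
    (a + b) * (↧ z * g)                      ≡⟨ lemma₄ (a + b) (↧ z) g ⟩
    (a + b) * ↧ z * g                        ∎))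
    where
    open ≡-Reasoning
    z = x ℚ.+ y
    g = +-gcd x y
    lemma₁ : ∀ u d g → u * d * g ≡ u * g * d
    lemma₁ = solve-∀
    lemma₂ : ∀ u v k l d → (u * l + v * k) * d ≡ u * d * l + v * d * k
    lemma₂ = solve-∀
    lemma₃ : ∀ a b k l → a * k * l + b * l * k ≡ (a + b) * (k * l)
    lemma₃ = solve-∀
    lemma₄ : ∀ a l g → a * (l * g) ≡ a * l * g
    lemma₄ = solve-∀

  lowest-terms : ∀ x → Coprime ∣ ↥ x ∣ (↧ₙ x)
  lowest-terms (mkℚ a d-1 coprime) = recompute coprime

-- Transfer of the integer congruence to the rational sum.

open import Data.Nat.DivMod using (_/_)
open import Data.Nat using (ℕ; _<_; _∸_; _^_; _*_; _+_)
open import Data.Nat.Primality using (Prime)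
open import Data.Nat.Combinatorics using (_C_)
open import Data.Nat.Properties using (m^n≢0)
open import Data.Integer as ℤ using (+_)
open import Data.Rational as ℚ using (ℚ)
open IntegerArithmetic
open Fractions

pos-^ : ∀ b k → + (b ^ k) ≡ (+ b) ℤ.^ k
pos-^ b zero    = refl
pos-^ b (suc k) = trans (pos-* b (b ^ k)) (cong (+ b ℤ.*_) (pos-^ b k))

summand : ℕ → ℚ
summand k = ℚ._/_ (+ ((3 * k + 1) * ((2 * k) C k) ^ 3)) (16 ^ k) {{m^n≢0 16 k}}

summandNumerator : ℕ → ℤ
summandNumerator k = (+ 3 ℤ.* + k ℤ.+ + 1) ℤ.* (central k ℤ.* central k ℤ.* central k)

summandNumerator≡ : ∀ k → + ((3 * k + 1) * ((2 * k) C k) ^ 3) ≡ summandNumerator k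
summandNumerator≡ k = begin
  + ((3 * k + 1) * ((2 * k) C k) ^ 3)
    ≡⟨ cong (λ j → + ((3 * k + 1) * (j C k) ^ 3)) (cong (λ i → k + i) (ℕₚ.+-identityʳ k)) ⟩
  + ((3 * k + 1) * ((k + k) C k) ^ 3)
    ≡⟨ pos-* (3 * k + 1) (((k + k) C k) ^ 3) ⟩
  (+ (3 * k) ℤ.+ + 1) ℤ.* + (((k + k) C k) ^ 3)
    ≡⟨ cong₂ (λ x y → (x ℤ.+ + 1) ℤ.* y) (pos-* 3 k) (pos-^ ((k + k) C k) 3) ⟩
  (+ 3 ℤ.* + k ℤ.+ + 1) ℤ.* central k ℤ.^ 3
    ≡⟨ cong ((+ 3 ℤ.* + k ℤ.+ + 1) ℤ.*_) (cube (central k)) ⟩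
  summandNumerator k ∎
  where
  open ≡-Reasoning
  cube : ∀ x → x ℤ.* (x ℤ.* (x ℤ.* + 1)) ≡ x ℤ.* x ℤ.* x
  cube = solve-∀

represents-summand : ∀ k → Represents (summand k) (summandNumerator k) ((+ 16) ℤ.^ k)
represents-summand k = subst₂ (Represents (summand k)) (summandNumerator≡ k) (pos-^ 16 k)
  (represents-/ (+ ((3 * k + 1) * ((2 * k) C k) ^ 3)) (16 ^ k) {{m^n≢0 16 k}})

represents-sum : ∀ n → Represents (sumℚ n summand) (numerator n) ((+ 16) ℤ.^ n)
represents-sum zero    = represents-summand 0
represents-sum (suc n) = represents-+ {sumℚ n summand} {summand (suc n)}
  (represents-scale {sumℚ n summand} (+ 16) (represents-sum n)) (represents-summand (suc n))

≅0⇒∣ : ∀ p e z → z ≅ + 0 [ (+ p) ℤ.^ e ] → p ^ e ∣ ∣ z ∣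
≅0⇒∣ p e z (by t eq) = divides ∣ t ∣ (begin
  ∣ z ∣                                ≡⟨ cong ∣_∣ (trans eq (ℤₚ.+-identityˡ ((+ p) ℤ.^ e ℤ.* t))) ⟩
  ∣ (+ p) ℤ.^ e ℤ.* t ∣                ≡⟨ cong (λ m → ∣ m ℤ.* t ∣) (pos-^ p e) ⟨
  ∣ + (p ^ e) ℤ.* t ∣                  ≡⟨ abs-* (+ (p ^ e)) t ⟩
  p ^ e * ∣ t ∣                        ≡⟨ ℕₚ.*-comm (p ^ e) ∣ t ∣ ⟩
  ∣ t ∣ * p ^ e                        ∎)
  where open ≡-Reasoning

-- Both halves of the conclusion follow from divisibility of the reduced numerator: the exponent is
-- positive, so p divides that numerator, and lowest terms then make the denominator coprime to p.
fraction≅0 : ∀ p e z a d .{{_ : NonZero p}} → Represents z a d → Unit (+ p) d →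
  a ≅ + 0 [ (+ p) ℤ.^ suc e ] → (p ^ suc e ∣ ∣ ↥ z ∣) × Coprime (↧ₙ z) p
fraction≅0 p e z a d r unit-d a≅0 = pᵉ∣↥z ,
  λ (i∣↧z , i∣p) → lowest-terms z (∣-trans i∣p (∣-trans (m∣m*n (p ^ e)) pᵉ∣↥z) , i∣↧z)
  where
  pᵉ∣↥z : p ^ suc e ∣ ∣ ↥ z ∣
  pᵉ∣↥z = ≅0⇒∣ p (suc e) (↥ z) (≅0-cancel unit-d (suc e)
    (≡-≅ (trans (ℤₚ.*-comm d (↥ z)) (Represents.cross r)) (*-cong-≅ a≅0 (≅-refl {a = ↧ z}))))

mod-from-fraction : ∀ p e x y a b d .{{_ : NonZero p}} → Represents x a d → Represents y b (+ 1) →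
  Unit (+ p) d → a ≅ d ℤ.* b [ (+ p) ℤ.^ suc e ] → x ≡ y mod[ p ]^ suc e
mod-from-fraction p e x y a b d rx ry unit-d a≅db =
  fraction≅0 p e (x ℚ.- y) (a ℤ.+ d ℤ.* (ℤ.- b)) d difference unit-d
    (≅-≡ (+-cong-≅ a≅db (≅-refl {a = d ℤ.* (ℤ.- b)})) (cancel d b))
  where
  difference : Represents (x ℚ.- y) (a ℤ.+ d ℤ.* (ℤ.- b)) d
  difference = represents-+ rx (subst (Represents (ℚ.- y) (d ℤ.* (ℤ.- b))) (ℤₚ.*-identityʳ d)
    (represents-scale d (represents-neg ry)))
  cancel : ∀ d b → d ℤ.* b ℤ.+ d ℤ.* (ℤ.- b) ≡ + 0
  cancel = solve-∀

supercongruence : ∀ n (pr : Prime (suc (n + n))) m → n + n ≡ suc (suc (suc m)) →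
  sumℚ n summand
  ≡ (((+ suc (n + n)) ℤ.+ (+ 2) ℤ.* negOnePow n ℤ.* ((+ suc (n + n)) ℤ.^ 3) ℤ.* euler (suc m)) ℚ./ 1) mod[ suc (n + n) ]^ 4
supercongruence n pr m eq = mod-from-fraction (suc (n + n)) 3 (sumℚ n summand) (target ℚ./ 1) (numerator n) target ((+ 16) ℤ.^ n)
  (represents-sum n) (represents-/ target 1)
  (^-unit n (*-unit (*-unit two two) (*-unit two two))) numerator≅
  where
  open OddPrime n pr m eq using (target; numerator≅) renaming (two-unit to two)

double/2 : ∀ h → (h + h) / 2 ≡ h
double/2 h = trans (cong (_/ 2) (trans (cong (λ i → h + i) (sym (ℕₚ.+-identityʳ h))) (ℕₚ.*-comm 2 h))) (m*n/n≡m h 2)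

even-not-prime : ∀ h → 3 < h + h → Prime (h + h) → ∀ {A : Set} → A
even-not-prime h 3<p pr with prime⇒irreducible pr (divides h (trans (cong (λ i → h + i) (sym (ℕₚ.+-identityʳ h))) (ℕₚ.*-comm 2 h)))
... | inj₂ 2≡p with subst (3 <_) (sym 2≡p) 3<p
...   | s≤s (s≤s ())

Supercongruence : ℕ → Set
Supercongruence p = sumℚ ((p ∸ 1) / 2) summand
  ≡ (((+ p) ℤ.+ (+ 2) ℤ.* legendreMinusOne p ℤ.* ((+ p) ℤ.^ 3) ℤ.* euler (p ∸ 3)) ℚ./ 1) mod[ p ]^ 4

-- `Goal` abstracts the two indices that do not reduce for a variable h, namely (p - 1) / 2 and p -
-- 3. The hypothesis p > 3 yields the decomposition 2h = 3 + m.
supercongruence-odd : ∀ h → Prime (suc (h + h)) → 3 < suc (h + h) → Supercongruence (suc (h + h))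
supercongruence-odd h pr (s≤s 3≤2h) = subst₂ Goal (sym (double/2 h)) (sym (cong (_∸ 2) 2h≡))
  (supercongruence h pr (h + h ∸ 3) 2h≡)
  where
  P : ℤ
  P = + suc (h + h)
  Goal : ℕ → ℕ → Set
  Goal k j = sumℚ k summand
    ≡ ((P ℤ.+ (+ 2) ℤ.* negOnePow k ℤ.* (P ℤ.^ 3) ℤ.* euler j) ℚ./ 1) mod[ suc (h + h) ]^ 4
  2h≡ : h + h ≡ suc (suc (suc (h + h ∸ 3)))
  2h≡ = sym (ℕₚ.m+[n∸m]≡n 3≤2h)

supercongruence-prime : ∀ p → (∃ λ h → p ≡ h + h ⊎ p ≡ suc (h + h)) → Prime p → 3 < p → Supercongruence p
supercongruence-prime _ (h , inj₁ refl) pr 3<p = even-not-prime h 3<p pr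
supercongruence-prime _ (h , inj₂ refl) pr 3<p = supercongruence-odd h pr 3<p

theorem1p2 : (p : ℕ) → Prime p → 3 < p →
    sumℚ ((p ∸ 1) / 2)
    (λ k → ℚ._/_ (+ ((3 * k + 1) * ((2 * k) C k) ^ 3)) (16 ^ k) {{m^n≢0 16 k}})
    ≡ (((+ p) ℤ.+ (+ 2) ℤ.* legendreMinusOne p ℤ.* ((+ p) ℤ.^ 3) ℤ.* euler (p ∸ 3)) ℚ./ 1) mod[ p ]^ 4
theorem1p2 p = supercongruence-prime p (halves p)
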